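{- Let $k$ be a positive integer and let $p$ be a binary word of length $\ell$ with $r\ge 2$ runs. Then for $n$ sufficiently large, $B_p(n,k)$ is a polynomial in $n$ of degree at most $\ell-r+1$. Furthermore, if either (i) $p$ has a run of length $1$, or (ii) $p$ has a run of length $b\ge 2$ at its boundary such that $\binom{b+s}{b}=k$ for some integer $s\ge 0$, then $\deg(B_p(n,k))=\ell-r+1$.
   Context: A binary word of length $n$ is a string $w=w_1\cdots w_n\in\{0,1\}^n$. An occurrence of $p=p_1\cdots p_\ell$ in $w=w_1\cdots w_n$ is a choice of indices $1\le i_1<\cdots<i_\ell\le n$ (not necessarily consecutive) such that $w_{i_1}\cdots w_{i_\ell}=p$. Let $c_p(w)$ be the number of occurrences of $p$ in $w$, and let $B_p(n,k)=|\{w\in\{0,1\}^n : c_p(w)=k\}|$. A run of length $L$ in a binary word is a maximal block of $L$ consecutive equal letters. A run is at the boundary of $p$ if it is the first or the last run of $p$. The degree of $B_p(n,k)$ means the degree of the polynomial in $n$ with which $B_p(n,k)$ agrees for all sufficiently large $n$ ($k$ and $p$ fixed). -}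

module Defs where

open import Data.Bool using (Bool; false; true)
import Data.Bool.Properties as Bool
open import Data.Fin using (Fin; _<_)
import Data.Fin.Properties as Fin
open import Data.Integer using (+_)
open import Data.List using (List; []; _∷_; allFin; cartesianProductWith; filter; foldr; head; last; length; map)
open import Data.List.Membership.Propositional using (_∈_)
open import Data.List.NonEmpty as List⁺ using (List⁺; groupSeqsᵇ)
open import Data.Maybe using (just)
open import Data.Nat as ℕ using (ℕ; zero; suc)
open import Data.Product using (∃-syntax; _×_)
open import Data.Rational using (ℚ; 0ℚ; _+_; _*_; _/_)
open import Data.Sum using (_⊎_; [_,_]′)
open import Data.Vec as Vec using (Vec)
import Data.Vec.Properties as Vec
open import Data.Vec.Relation.Unary.AllPairs using (AllPairs; allPairs?)
open import Function using (id)
open import Relation.Binary.PropositionalEquality using (_≡_; _≢_)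
open import Relation.Nullary using (Dec)
open import Relation.Nullary.Decidable using (_×-dec_)

-- The letter 0 is false, the letter 1 is true.
Word : ℕ → Set
Word n = Vec Bool n

-- All vectors of length n with entries from xs, each listed once when xs has
-- no repetitions.
vectors : ∀ {A : Set} → List A → (n : ℕ) → List (Vec A n)
vectors xs zero    = Vec.[] ∷ []
vectors xs (suc n) = cartesianProductWith Vec._∷_ xs (vectors xs n)

words : (n : ℕ) → List (Word n)
words = vectors (false ∷ true ∷ [])

-- Indices i₁ < ⋯ < iₗ (starting from 0) with w at i₁, …, iₗ spelling p.
IsOccurrence : ∀ {ℓ n} → Word ℓ → Word n → Vec (Fin n) ℓ → Set
IsOccurrence p w is = AllPairs _<_ is × Vec.map (Vec.lookup w) is ≡ p

isOccurrence? : ∀ {ℓ n} (p : Word ℓ) (w : Word n) (is : Vec (Fin n) ℓ) →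
                Dec (IsOccurrence p w is)
isOccurrence? p w is =
  allPairs? Fin._<?_ is ×-dec Vec.≡-dec Bool._≟_ (Vec.map (Vec.lookup w) is) p

occurrences : ∀ {ℓ n} → Word ℓ → Word n → ℕ
occurrences {ℓ} {n} p w = length (filter (isOccurrence? p w) (vectors (allFin n) ℓ))

B : ∀ {ℓ} → Word ℓ → ℕ → ℕ → ℕ
B p n k = length (filter (λ w → occurrences p w ℕ.≟ k) (words n))

-- groupSeqsᵇ id cuts a word into its maximal constant blocks, with the blocks
-- of 1s tagged inj₁ and the blocks of 0s tagged inj₂.
runs : ∀ {n} → Word n → List (List⁺ Bool ⊎ List⁺ Bool)
runs w = groupSeqsᵇ id (Vec.toList w)

runLengths : ∀ {n} → Word n → List ℕ
runLengths w = map [ List⁺.length , List⁺.length ]′ (runs w)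

HasRun : ∀ {n} → Word n → ℕ → Set
HasRun w L = L ∈ runLengths w

HasBoundaryRun : ∀ {n} → Word n → ℕ → Set
HasBoundaryRun w L = head (runLengths w) ≡ just L ⊎ last (runLengths w) ≡ just L

-- Coefficients in order of increasing power; trailing zeros are allowed.
Polynomial : Set
Polynomial = List ℚ

eval : Polynomial → ℚ → ℚ
eval f x = foldr (λ a v → a + x * v) 0ℚ f

coeff : Polynomial → ℕ → ℚ
coeff []      _       = 0ℚ
coeff (a ∷ f) zero    = a
coeff (a ∷ f) (suc i) = coeff f i

-- The zero polynomial has degree at most d for every d, and no exact degree.
DegreeAtMost : Polynomial → ℕ → Set
DegreeAtMost f d = ∀ i → d ℕ.< i → coeff f i ≡ 0ℚ

HasDegree : Polynomial → ℕ → Set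
HasDegree f d = coeff f d ≢ 0ℚ × DegreeAtMost f d

-- A polynomial is determined by its values at all large n, so at most one f
-- (up to trailing zeros) satisfies this for a given sequence; the degree of
-- the sequence is the degree of that f.
EventuallyEqual : (ℕ → ℕ) → Polynomial → Set
EventuallyEqual g f = ∃[ N ] (∀ n → N ℕ.≤ n → + g n / 1 ≡ eval f (+ n / 1))

{-# OPTIONS --safe #-}
-- Read a word from left to right and record, for every prefix of p, its number of
-- occurrences so far. Since only k matters in the end, the counts may be truncated
-- at k + 1, which gives a finite automaton whose states only ever increase. Hence
-- the number of accepted words of length n is eventually polynomial in n, of degree
-- one less than the largest number of self-loops met on an accepting route.
--
-- A self-loop on x occurs between the letters i and i + 1 of p only if both differ
-- from x, so i = 0, i = ℓ or pᵢ = pᵢ₊₁. There are ℓ − r + 2 such gaps, and a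
-- potential that increases neither under 0 nor under 1 charges each loop to a gap of
-- its own; this gives the upper bound. The bound is attained by the words that use
-- all gaps, once a run of length b of p has been stretched to b + s letters in such a
-- way that C(b + s, b) = k.
--
-- All eventual polynomials have nonnegative coefficients in the basis C(n − N, j), so
-- leading terms cannot cancel.
module Submission where

open import Defs
open import Data.Bool using (Bool; true; false; not; if_then_else_)
import Data.Bool.Properties as Bool
open import Data.Bool.Properties using (¬-not; not-¬; not-involutive)
open import Data.Empty using (⊥; ⊥-elim)
open import Data.Fin as Fin using (Fin; zero; suc)
import Data.Integer as ℤ
import Data.Integer.Properties as ℤ
open import Data.List using (List; []; _∷_; length; map; filter; last; _++_; allFin; tabulate; cartesianProductWith)
open import Data.List.Membership.Propositional using (_∈_)
open import Data.List.NonEmpty as List⁺ using (List⁺)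
open import Data.List.Properties using (length-++; length-map; filter-++; filter-≐; map-tabulate)
open import Data.List.Relation.Unary.Any using (here; there)
open import Data.Maybe using (just)
open import Data.Nat using (ℕ; zero; suc; _+_; _*_; _∸_; _≤_; _<_; z≤n; s≤s; _<?_; _≤?_; _≟_)
open import Data.Nat.Combinatorics using (_C_; nCk+nC[k+1]≡[n+1]C[k+1]; k>n⇒nCk≡0; nC1≡n)
open import Data.Nat.Properties hiding (_≟_; _≤?_; _<?_)
import Data.Nat.Solver as ℕ
open import Data.Product using (∃-syntax; Σ-syntax; _×_; _,_; proj₁; proj₂)
open import Data.Rational as ℚ using (ℚ; 0ℚ; 1ℚ; _/_)
import Data.Rational.Properties as ℚ
import Data.Rational.Solver as ℚ
import Data.Rational.Unnormalised as ℚᵘ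
import Data.Rational.Unnormalised.Properties as ℚᵘ
open import Data.Sum using (_⊎_; inj₁; inj₂; [_,_]′)
open import Data.Vec as Vec using (Vec; []; _∷_; lookup)
import Data.Vec.Properties as Vec
open import Data.Vec.Relation.Unary.All as All using (All; []; _∷_)
open import Data.Vec.Relation.Unary.AllPairs using (AllPairs; []; _∷_)
open import Function using (_∘_; id)
open import Function.Bundles using (mk⇔)
open import Relation.Binary.PropositionalEquality hiding ([_])
open import Relation.Nullary using (¬_; Dec; yes; no; does; contradiction)
open import Relation.Nullary.Decidable using (_×-dec_; dec-true; dec-false; does-⇔)
open import Relation.Unary using (Decidable)

-- Newton series

infix 8 _‼_
_‼_ : List ℕ → ℕ → ℕ
[]       ‼ _     = 0
(a ∷ as) ‼ zero  = a
(a ∷ as) ‼ suc j = as ‼ j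

-- Σⱼ aⱼ · C(n, i + j). Natural coefficients rule out cancellation; the offset `i` serves the
-- induction along the list.
newton : ℕ → List ℕ → ℕ → ℕ
newton i []       n = 0
newton i (a ∷ as) n = a * (n C i) + newton (suc i) as n

pascal : ∀ n k → suc n C suc k ≡ n C k + n C suc k
pascal n k = sym (nCk+nC[k+1]≡[n+1]C[k+1] n k)

newton-zero : ∀ i as → newton (suc i) as 0 ≡ 0
newton-zero i []       = refl
newton-zero i (a ∷ as) = cong₂ _+_ (*-zeroʳ a) (newton-zero (suc i) as)

-- Pascal's rule term by term: a first difference lowers the offset by one.
newton-suc : ∀ i as n → newton (suc i) as (suc n) ≡ newton (suc i) as n + newton i as n
newton-suc i []       n = refl
newton-suc i (a ∷ as) n = begin
  a * (suc n C suc i) + newton (2 + i) as (suc n)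
    ≡⟨ cong₂ (λ u v → a * u + v) (pascal n i) (newton-suc (suc i) as n) ⟩
  a * (n C i + n C suc i) + (newton (2 + i) as n + newton (suc i) as n)
    ≡⟨ solve 5 (λ a u v s t → a :* (u :+ v) :+ (s :+ t) := (a :* v :+ s) :+ (a :* u :+ t)) refl
         a (n C i) (n C suc i) (newton (2 + i) as n) (newton (suc i) as n) ⟩
  (a * (n C suc i) + newton (2 + i) as n) + (a * (n C i) + newton (suc i) as n) ∎
  where
  open ≡-Reasoning
  open ℕ.+-*-Solver

infixl 6 _⊕_
_⊕_ : List ℕ → List ℕ → List ℕ
[]       ⊕ bs       = bs
(a ∷ as) ⊕ []       = a ∷ as
(a ∷ as) ⊕ (b ∷ bs) = a + b ∷ as ⊕ bs

newton-⊕ : ∀ i as bs n → newton i (as ⊕ bs) n ≡ newton i as n + newton i bs n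
newton-⊕ i []       bs       n = refl
newton-⊕ i (a ∷ as) []       n = sym (+-identityʳ _)
newton-⊕ i (a ∷ as) (b ∷ bs) n = trans (cong ((a + b) * (n C i) +_) (newton-⊕ (suc i) as bs n))
  (solve 5 (λ a b c u v → (a :+ b) :* c :+ (u :+ v) := (a :* c :+ u) :+ (b :* c :+ v)) refl
     a b (n C i) (newton (suc i) as n) (newton (suc i) bs n))
  where open ℕ.+-*-Solver

‼-⊕ : ∀ as bs j → (as ⊕ bs) ‼ j ≡ as ‼ j + bs ‼ j
‼-⊕ []       bs       j       = refl
‼-⊕ (a ∷ as) []       j       = sym (+-identityʳ _)
‼-⊕ (a ∷ as) (b ∷ bs) zero    = refl
‼-⊕ (a ∷ as) (b ∷ bs) (suc j) = ‼-⊕ as bs j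

length-⊕ : ∀ as bs {m} → length as ≤ m → length bs ≤ m → length (as ⊕ bs) ≤ m
length-⊕ []       bs       p       q       = q
length-⊕ (a ∷ as) []       p       q       = p
length-⊕ (a ∷ as) (b ∷ bs) (s≤s p) (s≤s q) = s≤s (length-⊕ as bs p q)

-- By Pascal's rule, re-expansion at n + 1 has the coefficients aⱼ + aⱼ₊₁, so none of them
-- decreases.
shift : List ℕ → List ℕ
shift []       = []
shift (a ∷ as) = (a ∷ as) ⊕ as

newton-shift : ∀ as n → newton 0 (shift as) n ≡ newton 0 as (suc n)
newton-shift []       n = refl
newton-shift (a ∷ as) n = begin
  newton 0 ((a ∷ as) ⊕ as) n                        ≡⟨ newton-⊕ 0 (a ∷ as) as n ⟩
  a * (n C 0) + newton 1 as n + newton 0 as n         ≡⟨ +-assoc (a * (n C 0)) _ _ ⟩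
  a * (n C 0) + (newton 1 as n + newton 0 as n)
    ≡⟨ cong₂ (λ u v → a * u + v) refl (sym (newton-suc 0 as n)) ⟩
  a * (suc n C 0) + newton 1 as (suc n) ∎
  where open ≡-Reasoning

length-shift : ∀ as {m} → length as ≤ m → length (shift as) ≤ m
length-shift []       p = p
length-shift (a ∷ as) p = length-⊕ (a ∷ as) as p (≤-trans (n≤1+n _) p)

‼-shift : ∀ as j → as ‼ j ≤ shift as ‼ j
‼-shift []       j = z≤n
‼-shift (a ∷ as) j = ≤-trans (m≤m+n _ _) (≤-reflexive (sym (‼-⊕ (a ∷ as) as j)))

shiftBy : ℕ → List ℕ → List ℕ
shiftBy zero    as = as
shiftBy (suc m) as = shift (shiftBy m as)

newton-shiftBy : ∀ m as n → newton 0 (shiftBy m as) n ≡ newton 0 as (m + n)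
newton-shiftBy zero    as n = refl
newton-shiftBy (suc m) as n = trans (newton-shift (shiftBy m as) n)
  (trans (newton-shiftBy m as (suc n)) (cong (newton 0 as) (+-suc m n)))

length-shiftBy : ∀ m as {d} → length as ≤ d → length (shiftBy m as) ≤ d
length-shiftBy zero    as p = p
length-shiftBy (suc m) as p = length-shift (shiftBy m as) (length-shiftBy m as p)

‼-shiftBy : ∀ m as j → as ‼ j ≤ shiftBy m as ‼ j
‼-shiftBy zero    as j = ≤-refl
‼-shiftBy (suc m) as j = ≤-trans (‼-shiftBy m as j) (‼-shift (shiftBy m as) j)

‼-length : ∀ as j → length as ≤ j → as ‼ j ≡ 0
‼-length []       j       _       = refl
‼-length (a ∷ as) (suc j) (s≤s p) = ‼-length as j p

-- The identity (k + 1) · C(n, k + 1) = (n - k) · C(n, k) without subtraction; it yields the ratio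
-- in the Horner form below.
absorption : ∀ n k → suc k * (n C suc k) + k * (n C k) ≡ n * (n C k)
absorption zero zero = refl
absorption zero (suc k) = cong₂ _+_ (*-zeroʳ (2 + k)) (*-zeroʳ (suc k))
absorption (suc n) zero = begin
  1 * (suc n C 1) + 0      ≡⟨ trans (+-identityʳ _) (*-identityˡ _) ⟩
  suc n C 1              ≡⟨ pascal n 0 ⟩
  n C 0 + n C 1          ≡⟨ cong (n C 0 +_) (trans (sym (trans (+-identityʳ _) (*-identityˡ _))) (absorption n 0)) ⟩
  n C 0 + n * (n C 0)      ≡⟨ refl ⟩
  suc n C 0 + n * (suc n C 0) ∎
  where open ≡-Reasoning
absorption (suc n) (suc k) = begin
  (2 + k) * (suc n C (2 + k)) + suc k * (suc n C suc k)
    ≡⟨ cong₂ (λ u v → (2 + k) * u + suc k * v) (pascal n (suc k)) (pascal n k) ⟩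
  (2 + k) * (y + z) + suc k * (x + y)
    ≡⟨ solve 4 (λ k x y z → (con 2 :+ k) :* (y :+ z) :+ (con 1 :+ k) :* (x :+ y) :=
         (((con 2 :+ k) :* z :+ (con 1 :+ k) :* y) :+ ((con 1 :+ k) :* y :+ k :* x)) :+ (x :+ y)) refl k x y z ⟩
  (((2 + k) * z + suc k * y) + (suc k * y + k * x)) + (x + y)
    ≡⟨ cong₂ (λ u v → (u + v) + (x + y)) (absorption n (suc k)) (absorption n k) ⟩
  (n * y + n * x) + (x + y)
    ≡⟨ solve 3 (λ n x y → (n :* y :+ n :* x) :+ (x :+ y) := (con 1 :+ n) :* (x :+ y)) refl n x y ⟩
  suc n * (x + y)  ≡⟨ cong (suc n *_) (pascal n k) ⟨
  suc n * (suc n C suc k) ∎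
  where
  open ≡-Reasoning
  open ℕ.+-*-Solver
  x = n C k
  y = n C suc k
  z = n C (2 + k)

-- Newton series as polynomials over ℚ

fromℕ : ℕ → ℚ
fromℕ n = ℤ.+ n / 1

fromℕ-toℚᵘ : ∀ n → ℚ.toℚᵘ (fromℕ n) ℚᵘ.≃ ℚᵘ.mkℚᵘ (ℤ.+ n) 0
fromℕ-toℚᵘ n = ℚ.toℚᵘ-fromℚᵘ (ℚᵘ.mkℚᵘ (ℤ.+ n) 0)

fromℕ-+ : ∀ m n → fromℕ (m + n) ≡ fromℕ m ℚ.+ fromℕ n
fromℕ-+ m n = ℚ.toℚᵘ-injective (begin
  ℚ.toℚᵘ (fromℕ (m + n))                        ≈⟨ fromℕ-toℚᵘ (m + n) ⟩
  ℚᵘ.mkℚᵘ (ℤ.+ (m + n)) 0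
    ≈⟨ ℚᵘ.*≡* (cong (ℤ._* ℤ.+ 1) (cong₂ ℤ._+_ (sym (ℤ.*-identityʳ (ℤ.+ m))) (sym (ℤ.*-identityʳ (ℤ.+ n))))) ⟩
  ℚᵘ.mkℚᵘ (ℤ.+ m) 0 ℚᵘ.+ ℚᵘ.mkℚᵘ (ℤ.+ n) 0          ≈⟨ ℚᵘ.+-cong (fromℕ-toℚᵘ m) (fromℕ-toℚᵘ n) ⟨
  ℚ.toℚᵘ (fromℕ m) ℚᵘ.+ ℚ.toℚᵘ (fromℕ n)        ≈⟨ ℚ.toℚᵘ-homo-+ (fromℕ m) (fromℕ n) ⟨
  ℚ.toℚᵘ (fromℕ m ℚ.+ fromℕ n)                  ∎)
  where open import Relation.Binary.Reasoning.Setoid ℚᵘ.≃-setoid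

fromℕ-* : ∀ m n → fromℕ (m * n) ≡ fromℕ m ℚ.* fromℕ n
fromℕ-* m n = ℚ.toℚᵘ-injective (begin
  ℚ.toℚᵘ (fromℕ (m * n))                        ≈⟨ fromℕ-toℚᵘ (m * n) ⟩
  ℚᵘ.mkℚᵘ (ℤ.+ (m * n)) 0                         ≈⟨ ℚᵘ.*≡* (cong (ℤ._* ℤ.+ 1) (ℤ.pos-* m n)) ⟩
  ℚᵘ.mkℚᵘ (ℤ.+ m) 0 ℚᵘ.* ℚᵘ.mkℚᵘ (ℤ.+ n) 0          ≈⟨ ℚᵘ.*-cong (fromℕ-toℚᵘ m) (fromℕ-toℚᵘ n) ⟨
  ℚ.toℚᵘ (fromℕ m) ℚᵘ.* ℚ.toℚᵘ (fromℕ n)        ≈⟨ ℚ.toℚᵘ-homo-* (fromℕ m) (fromℕ n) ⟨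
  ℚ.toℚᵘ (fromℕ m ℚ.* fromℕ n)                  ∎)
  where open import Relation.Binary.Reasoning.Setoid ℚᵘ.≃-setoid

fromℕ-injective : ∀ {m n} → fromℕ m ≡ fromℕ n → m ≡ n
fromℕ-injective {m} {n} eq =
  ℤ.+-injective (trans (sym (ℤ.*-identityʳ (ℤ.+ m))) (trans (ℚᵘ.drop-*≡*
    (ℚᵘ.≃-trans (ℚᵘ.≃-sym (fromℕ-toℚᵘ m)) (ℚᵘ.≃-trans (ℚᵘ.≃-reflexive (cong ℚ.toℚᵘ eq)) (fromℕ-toℚᵘ n))))
    (ℤ.*-identityʳ (ℤ.+ n))))

1/suc : ℕ → ℚ
1/suc i = ℚ.1/_ (fromℕ (suc i)) {{ℚ.≢-nonZero (λ eq → 1+n≢0 (fromℕ-injective {suc i} {0} eq))}}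

suc*1/suc : ∀ i → fromℕ (suc i) ℚ.* 1/suc i ≡ 1ℚ
suc*1/suc i = ℚ.*-inverseʳ (fromℕ (suc i)) {{ℚ.≢-nonZero (λ eq → 1+n≢0 (fromℕ-injective {suc i} {0} eq))}}

affine : ℚ → ℚ → ℚ → Polynomial → Polynomial
affine s t u []      = u ∷ []
affine s t u (c ∷ f) = (u ℚ.+ s ℚ.* c) ∷ affine s t (t ℚ.* c) f

eval-affine : ∀ s t u f x → eval (affine s t u f) x ≡ u ℚ.+ (t ℚ.* x ℚ.+ s) ℚ.* eval f x
eval-affine s t u []      x = cong (u ℚ.+_)
  (trans (ℚ.*-zeroʳ x) (sym (ℚ.*-zeroʳ (t ℚ.* x ℚ.+ s))))
eval-affine s t u (c ∷ f) x = trans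
  (cong (λ v → (u ℚ.+ s ℚ.* c) ℚ.+ x ℚ.* v) (eval-affine s t (t ℚ.* c) f x))
  (solve 6 (λ s t u c x v → (u :+ s :* c) :+ x :* (t :* c :+ (t :* x :+ s) :* v)
                         := u :+ (t :* x :+ s) :* (c :+ x :* v)) refl s t u c x (eval f x))
  where open ℚ.+-*-Solver

coeff-affine-zero : ∀ s t u f → coeff (affine s t u f) 0 ≡ u ℚ.+ s ℚ.* coeff f 0
coeff-affine-zero s t u []      = sym (trans (cong (u ℚ.+_) (ℚ.*-zeroʳ s)) (ℚ.+-identityʳ u))
coeff-affine-zero s t u (c ∷ f) = refl

coeff-affine-suc : ∀ s t u f j →
  coeff (affine s t u f) (suc j) ≡ t ℚ.* coeff f j ℚ.+ s ℚ.* coeff f (suc j)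
coeff-affine-suc s t u []      j       =
  sym (trans (cong₂ ℚ._+_ (ℚ.*-zeroʳ t) (ℚ.*-zeroʳ s)) (ℚ.+-identityʳ 0ℚ))
coeff-affine-suc s t u (c ∷ f) zero    = coeff-affine-zero s t (t ℚ.* c) f
coeff-affine-suc s t u (c ∷ f) (suc j) = coeff-affine-suc s t (t ℚ.* c) f j

-- The Newton series Σⱼ aⱼ · C(x − N, i + j) / C(x − N, i), in Horner form:
-- C(y, i + 1) = C(y, i) · (y − i) / (i + 1).
newtonPoly : ℕ → ℕ → List ℕ → Polynomial
newtonPoly N i []       = []
newtonPoly N i (a ∷ as) =
  affine (ℚ.- fromℕ (N + i) ℚ.* 1/suc i) (1/suc i) (fromℕ a) (newtonPoly N (suc i) as)

C-ratio : ∀ N i n → fromℕ (n C i) ℚ.* (1/suc i ℚ.* fromℕ (N + n) ℚ.+ ℚ.- fromℕ (N + i) ℚ.* 1/suc i)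
                  ≡ fromℕ (n C suc i)
C-ratio N i n = begin
  c ℚ.* (t ℚ.* fromℕ (N + n) ℚ.+ ℚ.- fromℕ (N + i) ℚ.* t)
    ≡⟨ cong₂ (λ u v → c ℚ.* (t ℚ.* u ℚ.+ ℚ.- v ℚ.* t)) (fromℕ-+ N n) (fromℕ-+ N i) ⟩
  c ℚ.* (t ℚ.* (fromℕ N ℚ.+ x) ℚ.+ ℚ.- (fromℕ N ℚ.+ fromℕ i) ℚ.* t)
    ≡⟨ solve 5 (λ c t m x i → c :* (t :* (m :+ x) :+ :- (m :+ i) :* t) := t :* (x :* c :+ :- (i :* c)))
         refl c t (fromℕ N) x (fromℕ i) ⟩
  t ℚ.* (x ℚ.* c ℚ.+ ℚ.- (fromℕ i ℚ.* c))
    ≡⟨ cong (λ u → t ℚ.* (u ℚ.+ ℚ.- (fromℕ i ℚ.* c))) absorption-ℚ ⟨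
  t ℚ.* ((fromℕ (suc i) ℚ.* d ℚ.+ fromℕ i ℚ.* c) ℚ.+ ℚ.- (fromℕ i ℚ.* c))
    ≡⟨ solve 4 (λ t s d e → t :* ((s :* d :+ e) :+ :- e) := (s :* t) :* d) refl t (fromℕ (suc i)) d (fromℕ i ℚ.* c) ⟩
  (fromℕ (suc i) ℚ.* t) ℚ.* d  ≡⟨ cong (ℚ._* d) (suc*1/suc i) ⟩
  1ℚ ℚ.* d                     ≡⟨ ℚ.*-identityˡ d ⟩
  d ∎
  where
  open ≡-Reasoning
  open ℚ.+-*-Solver
  c = fromℕ (n C i)
  d = fromℕ (n C suc i)
  t = 1/suc i
  x = fromℕ n
  absorption-ℚ : fromℕ (suc i) ℚ.* d ℚ.+ fromℕ i ℚ.* c ≡ x ℚ.* c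
  absorption-ℚ = trans (sym (trans (fromℕ-+ (suc i * (n C suc i)) (i * (n C i)))
    (cong₂ ℚ._+_ (fromℕ-* (suc i) (n C suc i)) (fromℕ-* i (n C i)))))
    (trans (cong fromℕ (absorption n i)) (fromℕ-* n (n C i)))

-- `newtonPoly` has the factor C(x - N, i) divided out. It is multiplied back here because it
-- vanishes for n < i; at i = 0 it is 1.
eval-newtonPoly : ∀ N i as n →
  fromℕ (n C i) ℚ.* eval (newtonPoly N i as) (fromℕ (N + n)) ≡ fromℕ (newton i as n)
eval-newtonPoly N i []       n = ℚ.*-zeroʳ (fromℕ (n C i))
eval-newtonPoly N i (a ∷ as) n = begin
  c ℚ.* eval (affine s t (fromℕ a) f) x          ≡⟨ cong (c ℚ.*_) (eval-affine s t (fromℕ a) f x) ⟩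
  c ℚ.* (fromℕ a ℚ.+ (t ℚ.* x ℚ.+ s) ℚ.* eval f x)
    ≡⟨ solve 4 (λ c a u v → c :* (a :+ u :* v) := a :* c :+ (c :* u) :* v) refl c (fromℕ a) (t ℚ.* x ℚ.+ s) (eval f x) ⟩
  fromℕ a ℚ.* c ℚ.+ (c ℚ.* (t ℚ.* x ℚ.+ s)) ℚ.* eval f x
    ≡⟨ cong₂ (λ u v → u ℚ.+ v ℚ.* eval f x) (sym (fromℕ-* a (n C i))) (C-ratio N i n) ⟩
  fromℕ (a * (n C i)) ℚ.+ fromℕ (n C suc i) ℚ.* eval f x
    ≡⟨ cong (fromℕ (a * (n C i)) ℚ.+_) (eval-newtonPoly N (suc i) as n) ⟩
  fromℕ (a * (n C i)) ℚ.+ fromℕ (newton (suc i) as n) ≡⟨ fromℕ-+ (a * (n C i)) _ ⟨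
  fromℕ (a * (n C i) + newton (suc i) as n) ∎
  where
  open ≡-Reasoning
  open ℚ.+-*-Solver
  c = fromℕ (n C i)
  s = ℚ.- fromℕ (N + i) ℚ.* 1/suc i
  t = 1/suc i
  x = fromℕ (N + n)
  f = newtonPoly N (suc i) as

coeff-newtonPoly-≥ : ∀ N i as j → length as ≤ j → coeff (newtonPoly N i as) j ≡ 0ℚ
coeff-newtonPoly-≥ N i []       j       p       = refl
coeff-newtonPoly-≥ N i (a ∷ as) (suc j) (s≤s p) = begin
  coeff (newtonPoly N i (a ∷ as)) (suc j)
    ≡⟨ coeff-affine-suc s t (fromℕ a) f j ⟩
  t ℚ.* coeff f j ℚ.+ s ℚ.* coeff f (suc j)
    ≡⟨ cong₂ (λ u v → t ℚ.* u ℚ.+ s ℚ.* v) (coeff-newtonPoly-≥ N (suc i) as j p)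
         (coeff-newtonPoly-≥ N (suc i) as (suc j) (m≤n⇒m≤1+n p)) ⟩
  t ℚ.* 0ℚ ℚ.+ s ℚ.* 0ℚ  ≡⟨ cong₂ ℚ._+_ (ℚ.*-zeroʳ t) (ℚ.*-zeroʳ s) ⟩
  0ℚ ∎
  where
  open ≡-Reasoning
  s = ℚ.- fromℕ (N + i) ℚ.* 1/suc i
  t = 1/suc i
  f = newtonPoly N (suc i) as

-- This coefficient is the entry at `d` divided by (i + 1) ⋯ (i + d); multiplying by i + 1 strips
-- one factor per step.
coeff-newtonPoly-top : ∀ N i as d → length as ≤ suc d → 0 < as ‼ d → coeff (newtonPoly N i as) d ≢ 0ℚ
coeff-newtonPoly-top N i (a ∷ [])     zero    p q eq = <⇒≢ q (sym (fromℕ-injective eq))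
coeff-newtonPoly-top N i (_ ∷ _ ∷ _)  zero    (s≤s ()) q eq
coeff-newtonPoly-top N i (a ∷ as)     (suc d) (s≤s p) q eq =
  coeff-newtonPoly-top N (suc i) as d p q (begin
    coeff f d                              ≡⟨ ℚ.*-identityˡ (coeff f d) ⟨
    1ℚ ℚ.* coeff f d                       ≡⟨ cong (ℚ._* coeff f d) (suc*1/suc i) ⟨
    (fromℕ (suc i) ℚ.* t) ℚ.* coeff f d    ≡⟨ ℚ.*-assoc (fromℕ (suc i)) t (coeff f d) ⟩
    fromℕ (suc i) ℚ.* (t ℚ.* coeff f d)    ≡⟨ cong (fromℕ (suc i) ℚ.*_) t*coeff≡0 ⟩
    fromℕ (suc i) ℚ.* 0ℚ                   ≡⟨ ℚ.*-zeroʳ (fromℕ (suc i)) ⟩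
    0ℚ ∎)
  where
  open ≡-Reasoning
  s = ℚ.- fromℕ (N + i) ℚ.* 1/suc i
  t = 1/suc i
  f = newtonPoly N (suc i) as
  t*coeff≡0 : t ℚ.* coeff f d ≡ 0ℚ
  t*coeff≡0 = begin
    t ℚ.* coeff f d                            ≡⟨ ℚ.+-identityʳ _ ⟨
    t ℚ.* coeff f d ℚ.+ 0ℚ                     ≡⟨ cong (t ℚ.* coeff f d ℚ.+_) (ℚ.*-zeroʳ s) ⟨
    t ℚ.* coeff f d ℚ.+ s ℚ.* 0ℚ
      ≡⟨ cong (λ v → t ℚ.* coeff f d ℚ.+ s ℚ.* v) (coeff-newtonPoly-≥ N (suc i) as (suc d) p) ⟨
    t ℚ.* coeff f d ℚ.+ s ℚ.* coeff f (suc d)  ≡⟨ coeff-affine-suc s t (fromℕ a) f d ⟨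
    coeff (newtonPoly N i (a ∷ as)) (suc d)    ≡⟨ eq ⟩
    0ℚ ∎

newtonPoly-eventually : ∀ (g : ℕ → ℕ) N as → (∀ n → g (N + n) ≡ newton 0 as n) →
  EventuallyEqual g (newtonPoly N 0 as)
newtonPoly-eventually g N as eq = N , λ n N≤n → subst
  (λ m → fromℕ (g m) ≡ eval (newtonPoly N 0 as) (fromℕ m)) (m+[n∸m]≡n N≤n)
  (trans (cong fromℕ (eq (n ∸ N))) (trans (sym (eval-newtonPoly N 0 as (n ∸ N))) (ℚ.*-identityˡ _)))

-- The counting automaton

sumTo : (ℕ → ℕ) → ℕ → ℕ
sumTo f zero    = 0
sumTo f (suc n) = sumTo f n + f n

sumTo-mono : ∀ {f g} n → (∀ i → i < n → f i ≤ g i) → sumTo f n ≤ sumTo g n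
sumTo-mono zero    f≤g = z≤n
sumTo-mono (suc n) f≤g = +-mono-≤ (sumTo-mono n (λ i i<n → f≤g i (m≤n⇒m≤1+n i<n))) (f≤g n ≤-refl)

sumTo-strict : ∀ {f g} n j → j < n → f j < g j → (∀ i → i < n → f i ≤ g i) → sumTo f n < sumTo g n
sumTo-strict (suc n) j j≤n fj<gj f≤g with j ≟ n
... | yes refl = +-mono-≤-< (sumTo-mono n (λ i i<n → f≤g i (m≤n⇒m≤1+n i<n))) fj<gj
... | no  j≢n  = +-mono-<-≤
  (sumTo-strict n j (≤∧≢⇒< (≤-pred j≤n) j≢n) fj<gj (λ i i<n → f≤g i (m≤n⇒m≤1+n i<n))) (f≤g n ≤-refl)

∸-anti-< : ∀ {m n o} → o < n → o < m → m ∸ n < m ∸ o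
∸-anti-< {m} {n} o<n o<m with n ≤? m
... | yes n≤m = ∸-monoʳ-< o<n n≤m
... | no  n≰m = ≤-<-trans (≤-reflexive (m≤n⇒m∸n≡0 (<⇒≤ (≰⇒> n≰m)))) (m<n⇒0<n∸m o<m)

indicator : Bool → ℕ
indicator b = if b then 1 else 0

-- The state reached by a word u is the function j ↦ number of occurrences in u
-- of p₀ ⋯ pⱼ₋₁; only the indices j ≤ ℓ matter.
State : Set
State = ℕ → ℕ

initial : State
initial zero    = 1
initial (suc _) = 0

module Run (p : ℕ → Bool) where

  -- New occurrences of the prefix of length j + 1 end at the letter just read. Counts stay exact;
  -- truncation is left to `_≈_`.
  step : State → Bool → State
  step c x zero    = c 0
  step c x (suc j) = c (suc j) + (if does (p j Bool.≟ x) then c j else 0)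

  step-hit : ∀ {c x j} → p j ≡ x → step c x (suc j) ≡ c (suc j) + c j
  step-hit {c} {x} {j} eq rewrite dec-true (p j Bool.≟ x) eq = refl

  step-miss : ∀ {c x j} → p j ≢ x → step c x (suc j) ≡ c (suc j)
  step-miss {c} {x} {j} ne rewrite dec-false (p j Bool.≟ x) ne = +-identityʳ _

  step-≤ : ∀ c x j → c j ≤ step c x j
  step-≤ c x zero    = ≤-refl
  step-≤ c x (suc j) = m≤m+n _ _

  -- An invariant of reachable states: an occurrence of a prefix contains one of every shorter
  -- prefix.
  record Positive (c : State) : Set where
    field
      head-pos : 0 < c 0
      zero-suc : ∀ {j} → c j ≡ 0 → c (suc j) ≡ 0

    zero-mono : ∀ {i j} → i ≤ j → c i ≡ 0 → c j ≡ 0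
    zero-mono {j = zero}  z≤n eq = eq
    zero-mono {i} {suc j} i≤1+j eq with i ≟ suc j
    ... | yes refl = eq
    ... | no  i≢   = zero-suc (zero-mono (≤-pred (≤∧≢⇒< i≤1+j i≢)) eq)

    pos-mono : ∀ {i j} → i ≤ j → 0 < c j → 0 < c i
    pos-mono {i} i≤j 0<cj with c i in eq
    ... | zero  = contradiction (zero-mono i≤j eq) (<⇒≢ 0<cj ∘ sym)
    ... | suc _ = s≤s z≤n

  step-Positive : ∀ {c} x → Positive c → Positive (step c x)
  step-Positive {c} x pos = record { head-pos = head-pos ; zero-suc = zs }
    where
    open Positive pos
    zs : ∀ {j} → step c x j ≡ 0 → step c x (suc j) ≡ 0
    zs {zero}  eq = contradiction (sym eq) (<⇒≢ head-pos)
    zs {suc j} eq with does (p (suc j) Bool.≟ x)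
    ... | true  = cong₂ _+_ (zero-suc cj≡0) cj≡0
      where cj≡0 = m+n≡0⇒m≡0 (c (suc j)) eq
    ... | false = cong (_+ 0) (zero-suc (m+n≡0⇒m≡0 (c (suc j)) eq))

  initial-Positive : Positive initial
  initial-Positive = record { head-pos = s≤s z≤n ; zero-suc = λ { {zero} () ; {suc j} _ → refl } }

module Gaps (p : ℕ → Bool) (ℓ : ℕ) where

  -- A letter different from pᵢ₋₁ and pᵢ exists exactly if these two agree; at the
  -- ends i = 0 and i = ℓ there is only one letter to differ from.
  gapAt : ℕ → Bool
  gapAt zero    = true
  gapAt (suc i) = if does (suc i ≟ ℓ) then true else does (p i Bool.≟ p (suc i))

  gapAt-true : ∀ {i} → (suc i < ℓ → p i ≡ p (suc i)) → suc i ≤ ℓ → gapAt (suc i) ≡ true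
  gapAt-true {i} same i<ℓ with suc i ≟ ℓ
  ... | yes eq rewrite dec-true (suc i ≟ ℓ) eq = refl
  ... | no  i≢ℓ rewrite dec-false (suc i ≟ ℓ) i≢ℓ = dec-true (p i Bool.≟ p (suc i)) (same (≤∧≢⇒< i<ℓ i≢ℓ))

  gapAt-same : ∀ {i} → gapAt (suc i) ≡ true → suc i < ℓ → p i ≡ p (suc i)
  gapAt-same {i} gap i<ℓ rewrite dec-false (suc i ≟ ℓ) (<⇒≢ i<ℓ) with p i Bool.≟ p (suc i)
  ... | yes eq = eq
  ... | no  _  = contradiction gap λ ()

  -- The range is i, ..., i + m - 1, so `gaps 0 ℓ` omits the gap ℓ at the end: it is the intended
  -- degree, one less than the number of loops.
  gaps : ℕ → ℕ → ℕ
  gaps i zero    = 0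
  gaps i (suc m) = indicator (gapAt i) + gaps (suc i) m

  gaps-+ : ∀ i m n → gaps i (m + n) ≡ gaps i m + gaps (m + i) n
  gaps-+ i zero    n = refl
  gaps-+ i (suc m) n = trans (cong (indicator (gapAt i) +_)
    (trans (gaps-+ (suc i) m n) (cong (λ j → gaps (suc i) m + gaps j n) (+-suc m i))))
    (sym (+-assoc (indicator (gapAt i)) _ _))

module Automaton (p : ℕ → Bool) (ℓ k : ℕ) where
  open Run p public
  open Gaps p ℓ public

  K : ℕ
  K = suc k

  -- A matching letter leaves the truncated count of the longer prefix alone in two cases: there is
  -- nothing to extend, or that count is already saturated.
  Loop : State → Bool → Set
  Loop c x = ∀ {j} → j < ℓ → p j ≡ x → c j ≡ 0 ⊎ K ≤ c (suc j)

  Moves : State → Bool → ℕ → Set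
  Moves c x j = p j ≡ x × 0 < c j × c (suc j) < K

  Loop⇒¬Moves : ∀ {c x j} → Loop c x → j < ℓ → ¬ Moves c x j
  Loop⇒¬Moves loop j<ℓ (eq , 0<cj , <K) with loop j<ℓ eq
  ... | inj₁ cj≡0 = <⇒≢ 0<cj (sym cj≡0)
  ... | inj₂ K≤   = <⇒≱ <K K≤

  loop⊎moves : ∀ c x → Loop c x ⊎ ∃[ j ] j < ℓ × Moves c x j
  loop⊎moves c x with anyUpTo? (λ j → p j Bool.≟ x ×-dec 0 <? c j ×-dec c (suc j) <? K) ℓ
  ... | yes moves = inj₂ moves
  ... | no  none  = inj₁ loop
    where
    loop : Loop c x
    loop {j} j<ℓ eq with c j ≟ 0 | K ≤? c (suc j)
    ... | yes cj≡0 | _      = inj₁ cj≡0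
    ... | no  _    | yes K≤ = inj₂ K≤
    ... | no  cj≢0 | no K≰  = contradiction (j , j<ℓ , eq , n≢0⇒n>0 cj≢0 , ≰⇒> K≰) none

  -- Equivalent to min(u, K) = min(v, K), in a form suited to case analysis.
  _≃_ : ℕ → ℕ → Set
  u ≃ v = u ≡ v ⊎ (K ≤ u × K ≤ v)

  +-≃ : ∀ {u u′ v v′} → u ≃ u′ → v ≃ v′ → (u + v) ≃ (u′ + v′)
  +-≃ (inj₁ refl) (inj₁ refl) = inj₁ refl
  +-≃ {u} {u′} {v} {v′} (inj₁ _) (inj₂ (q , q′)) = inj₂ (≤-trans q (m≤n+m v u) , ≤-trans q′ (m≤n+m v′ u′))
  +-≃ {u} {u′} {v} {v′} (inj₂ (q , q′)) _ = inj₂ (≤-trans q (m≤m+n u v) , ≤-trans q′ (m≤m+n u′ v′))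

  ≃-trans : ∀ {u v w} → u ≃ v → v ≃ w → u ≃ w
  ≃-trans (inj₁ refl) r = r
  ≃-trans (inj₂ q) (inj₁ refl) = inj₂ q
  ≃-trans (inj₂ (q , _)) (inj₂ (_ , q′)) = inj₂ (q , q′)

  infix 4 _≈_
  _≈_ : State → State → Set
  c ≈ d = ∀ {j} → j ≤ ℓ → c j ≃ d j

  step-cong : ∀ {c d} x → c ≈ d → step c x ≈ step d x
  step-cong x c≈d {zero}  j≤ℓ = c≈d j≤ℓ
  step-cong x c≈d {suc j} j<ℓ with does (p j Bool.≟ x)
  ... | true  = +-≃ (c≈d j<ℓ) (c≈d (<⇒≤ j<ℓ))
  ... | false = +-≃ (c≈d j<ℓ) (inj₁ refl)

  Loop⇒step≈ : ∀ {c x} → Loop c x → step c x ≈ c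
  Loop⇒step≈ loop {zero} _ = inj₁ refl
  Loop⇒step≈ {c} {x} loop {suc j} j<ℓ with p j Bool.≟ x
  ... | no  _  = inj₁ (+-identityʳ _)
  ... | yes eq with loop j<ℓ eq
  ...   | inj₁ cj≡0 = inj₁ (trans (cong (c (suc j) +_) cj≡0) (+-identityʳ _))
  ...   | inj₂ K≤   = inj₂ (≤-trans K≤ (m≤m+n _ _) , K≤)

  Loop-cong : ∀ {c d x} → c ≈ d → Loop c x → Loop d x
  Loop-cong c≈d loop j<ℓ eq with c≈d (<⇒≤ j<ℓ) | c≈d j<ℓ | loop j<ℓ eq
  ... | inj₁ cj≡ | _ | inj₁ cj≡0 = inj₁ (trans (sym cj≡) cj≡0)
  ... | inj₂ (K≤ , _) | _ | inj₁ cj≡0 = contradiction (subst (K ≤_) cj≡0 K≤) λ ()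
  ... | _ | inj₁ eq′ | inj₂ K≤ = inj₂ (subst (K ≤_) eq′ K≤)
  ... | _ | inj₂ (_ , K≤) | inj₂ _ = inj₂ K≤

  accept-cong : ∀ {c d} → c ≈ d → c ℓ ≡ k → d ℓ ≡ k
  accept-cong c≈d eq with c≈d ≤-refl
  ... | inj₁ eq′      = trans (sym eq′) eq
  ... | inj₂ (K≤ , _) = contradiction (subst (K ≤_) eq K≤) (<⇒≱ ≤-refl)

  ≈-sym : ∀ {c d} → c ≈ d → d ≈ c
  ≈-sym c≈d j≤ℓ with c≈d j≤ℓ
  ... | inj₁ eq      = inj₁ (sym eq)
  ... | inj₂ (q , r) = inj₂ (r , q)

  count : State → ℕ → ℕ
  count c zero    = indicator (does (c ℓ ≟ k))
  count c (suc n) = count (step c false) n + count (step c true) n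

  count-cong : ∀ {c d} n → c ≈ d → count c n ≡ count d n
  count-cong {c} {d} zero c≈d = cong indicator
    (does-⇔ (mk⇔ (accept-cong c≈d) (accept-cong (≈-sym c≈d))) (c ℓ ≟ k) (d ℓ ≟ k))
  count-cong (suc n) c≈d = cong₂ _+_ (count-cong n (step-cong false c≈d)) (count-cong n (step-cong true c≈d))

  count-suc : ∀ c x n → count c (suc n) ≡ count (step c x) n + count (step c (not x)) n
  count-suc c false n = refl
  count-suc c true  n = +-comm (count (step c false) n) _

  count-loop : ∀ {c x} n → Loop c x → count c (suc n) ≡ count c n + count (step c (not x)) n
  count-loop {c} {x} n loop = trans (count-suc c x n) (cong (_+ count (step c (not x)) n) (count-cong n (Loop⇒step≈ loop)))

  count-loop-mono : ∀ {c x} m n → Loop c x → count c n ≤ count c (m + n)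
  count-loop-mono zero    n loop = ≤-refl
  count-loop-mono (suc m) n loop = ≤-trans (count-loop-mono m n loop)
    (≤-trans (m≤m+n _ _) (≤-reflexive (sym (count-loop (m + n) loop))))

  -- A route through the automaton along which e + 1 loops can be traversed
  -- arbitrarily often, the last one at the accepting end.
  data Path : ℕ → State → Set where
    stop  : ∀ {c} x → Loop c x → c ℓ ≡ k → Path 0 c
    _◂_   : ∀ {e c} x → Path e (step c x) → Path e c
    pivot : ∀ {e c} x → Loop c x → Path e (step c (not x)) → Path (suc e) c

  Above : ℕ → State → Set
  Above i c = ∀ {j} → i < j → j ≤ ℓ → c j ≡ 0

  step-zero : ∀ {c x j} → c (suc j) ≡ 0 → c j ≡ 0 → step c x (suc j) ≡ 0
  step-zero {c} {x} {j} eq eq′ with does (p j Bool.≟ x)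
  ... | true  = cong₂ _+_ eq eq′
  ... | false = cong (_+ 0) eq

  Above-step-suc : ∀ {c x i} → Above i c → Above (suc i) (step c x)
  Above-step-suc {c} above {suc j} (s≤s i<j) j<ℓ =
    step-zero {c} (above (m≤n⇒m≤1+n i<j) j<ℓ) (above i<j (<⇒≤ j<ℓ))

  Above-step : ∀ {c x i} → (i < ℓ → p i ≢ x) → Above i c → Above i (step c x)
  Above-step {c} {i = i} miss above {suc j} i<1+j j<ℓ with i ≟ j
  ... | yes refl = trans (step-miss {c} (miss j<ℓ)) (above i<1+j j<ℓ)
  ... | no  i≢j  = step-zero {c} (above i<1+j j<ℓ) (above (≤∧≢⇒< (≤-pred i<1+j) i≢j) (<⇒≤ j<ℓ))

  -- The longest prefix of p already seen has more than k occurrences, so every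
  -- completion to an occurrence of p creates more than k of them.
  Dead : State → Set
  Dead c = ∃[ i ] i ≤ ℓ × K ≤ c i × Above i c

  -- If the next letter of p is read, saturation passes on to the next prefix; otherwise the longest
  -- prefix seen stays the same.
  step-Dead : ∀ {c} x → Dead c → Dead (step c x)
  step-Dead {c} x (i , i≤ℓ , K≤ci , above) with p i Bool.≟ x | i <? ℓ
  ... | yes eq | yes i<ℓ = suc i , i<ℓ
      , ≤-trans K≤ci (≤-trans (m≤n+m (c i) (c (suc i))) (≤-reflexive (sym (step-hit {c} eq))))
      , Above-step-suc {c} above
  ... | no neq | _ = i , i≤ℓ , ≤-trans K≤ci (step-≤ c x i) , Above-step {c} (λ _ → neq) above
  ... | yes _ | no i≮ℓ = i , i≤ℓ , ≤-trans K≤ci (step-≤ c x i)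
      , λ i<j j≤ℓ → contradiction (≤-trans i<j j≤ℓ) i≮ℓ

  Dead⇒rejects : ∀ {c} → 0 < k → Dead c → c ℓ ≢ k
  Dead⇒rejects 0<k (i , i≤ℓ , K≤ci , above) eq with i ≟ ℓ
  ... | yes refl = <⇒≱ (≤-reflexive (cong suc eq)) K≤ci
  ... | no  i≢ℓ  = <⇒≢ 0<k (trans (sym (above (≤∧≢⇒< i≤ℓ i≢ℓ) ≤-refl)) eq)

  Dead⇒count≡0 : ∀ {c} → 0 < k → Dead c → ∀ n → count c n ≡ 0
  Dead⇒count≡0 {c} 0<k dead zero rewrite dec-false (c ℓ ≟ k) (Dead⇒rejects 0<k dead) = refl
  Dead⇒count≡0 0<k dead (suc n) =
    cong₂ _+_ (Dead⇒count≡0 0<k (step-Dead false dead) n) (Dead⇒count≡0 0<k (step-Dead true dead) n)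

  Dead⇒¬Path : ∀ {c e} → 0 < k → Dead c → ¬ Path e c
  Dead⇒¬Path 0<k dead (stop x loop eq) = Dead⇒rejects 0<k dead eq
  Dead⇒¬Path 0<k dead (x ◂ path) = Dead⇒¬Path 0<k (step-Dead x dead) path
  Dead⇒¬Path 0<k dead (pivot x loop path) = Dead⇒¬Path 0<k (step-Dead (not x) dead) path

  Dead-cong : ∀ {c d} → c ≈ d → Dead c → Dead d
  Dead-cong c≈d (i , i≤ℓ , K≤ci , above) = i , i≤ℓ , K≤di , above′
    where
    K≤di : K ≤ _
    K≤di with c≈d i≤ℓ
    ... | inj₁ eq       = subst (K ≤_) eq K≤ci
    ... | inj₂ (_ , K≤) = K≤
    above′ : ∀ {j} → i < j → j ≤ ℓ → _ ≡ 0
    above′ i<j j≤ℓ with c≈d j≤ℓ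
    ... | inj₁ eq       = trans (sym eq) (above i<j j≤ℓ)
    ... | inj₂ (K≤ , _) = contradiction (subst (K ≤_) (above i<j j≤ℓ) K≤) λ ()

  -- Termination measure: the total increase left before all truncated counts are full.
  room : State → ℕ
  room c = sumTo (λ j → K ∸ c (suc j)) ℓ

  room-< : ∀ {c x j} → j < ℓ → Moves c x j → room (step c x) < room c
  room-< {c} {x} {j} j<ℓ (eq , 0<cj , <K) = sumTo-strict ℓ j j<ℓ
    (∸-anti-< (<-≤-trans (m<m+n (c (suc j)) 0<cj) (≤-reflexive (sym (step-hit {c} eq)))) <K)
    (λ i _ → ∸-monoʳ-≤ K (step-≤ c x (suc i)))

-- Growth of the number of accepted words

module Growths (p : ℕ → Bool) (ℓ k : ℕ) (0<k : 0 < k)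
  (a : Bool) (b : ℕ) (0<b : 0 < b) (b<ℓ : b < ℓ) (p≡a : ∀ {i} → i < b → p i ≡ a) (pb≢a : p b ≢ a)
  where
  open Automaton p ℓ k

  -- The letter i stands for the gap i inside the first run, and for the gap i + 1
  -- after it; the index b between the two is not a gap.
  weight : ℕ → ℕ → ℕ
  weight i v = if does (i <? b)
    then indicator (does (v ≟ 0))
    else indicator (gapAt (suc i)) * indicator (does (v <? K))

  indicator-mono : ∀ {P Q : Set} (P? : Dec P) (Q? : Dec Q) → (P → Q) → indicator (does P?) ≤ indicator (does Q?)
  indicator-mono (no  _)  _       _   = z≤n
  indicator-mono (yes _)  (yes _) _   = ≤-refl
  indicator-mono (yes pf) (no ¬q) P⇒Q = contradiction (P⇒Q pf) ¬q

  weight-anti : ∀ i {u v} → u ≤ v → weight i v ≤ weight i u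
  weight-anti i {u} {v} u≤v with does (i <? b)
  ... | true  = indicator-mono (v ≟ 0) (u ≟ 0) λ { refl → n≤0⇒n≡0 u≤v }
  ... | false = *-monoʳ-≤ (indicator (gapAt (suc i))) (indicator-mono (v <? K) (u <? K) (≤-<-trans u≤v))

  -- This will bound the number of Newton coefficients of `count`. Weights only fall as counts grow,
  -- so no letter raises it.
  potential : State → ℕ
  potential c = sumTo (λ i → weight i (c (suc i))) ℓ

  potential-step : ∀ c x → potential (step c x) ≤ potential c
  potential-step c x = sumTo-mono ℓ (λ i _ → weight-anti i (step-≤ c x (suc i)))

  Drops : State → ℕ → Set
  Drops c j = weight j (c (suc j) + c j) < weight j (c (suc j))

  drops-first : ∀ {c j} → j < b → 0 < c j → c (suc j) ≡ 0 → Drops c j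
  drops-first {c} {j} j<b 0<cj eq rewrite dec-true (j <? b) j<b | eq
    | dec-false (c j ≟ 0) (<⇒≢ 0<cj ∘ sym) = ≤-refl

  drops-last : ∀ {c j} → b ≤ j → gapAt (suc j) ≡ true → K ≤ c j → c (suc j) < K → Drops c j
  drops-last {c} {j} b≤j gap K≤ <K rewrite dec-false (j <? b) (≤⇒≯ b≤j) | gap
    | dec-true (c (suc j) <? K) <K
    | dec-false (c (suc j) + c j <? K) (≤⇒≯ (≤-trans K≤ (m≤n+m (c j) (c (suc j))))) = ≤-refl

  potential-< : ∀ {c x j} → j < ℓ → p j ≡ x → Drops c j → potential (step c x) < potential c
  potential-< {c} {x} {j} j<ℓ eq drops = sumTo-strict ℓ j j<ℓ
    (≤-<-trans (≤-reflexive (cong (weight j) (step-hit {c} eq))) drops)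
    (λ i _ → weight-anti i (step-≤ c x (suc i)))

  firstZero : ∀ (c : State) n → 0 < c 0 → c n ≡ 0 → ∃[ j ] j < n × 0 < c j × c (suc j) ≡ 0
  firstZero c zero    0<c0 eq = contradiction (sym eq) (<⇒≢ 0<c0)
  firstZero c (suc n) 0<c0 eq with c n ≟ 0
  ... | no  cn≢0 = n , ≤-refl , n≢0⇒n>0 cn≢0 , eq
  ... | yes cn≡0 with firstZero c n 0<c0 cn≡0
  ...   | j , j<n , rest = j , m≤n⇒m≤1+n j<n , rest

  lastFull : ∀ (c : State) n →
    (∃[ i ] i ≤ n × K ≤ c i × (∀ {j} → i < j → j ≤ n → c j < K)) ⊎ (∀ {j} → j ≤ n → c j < K)
  lastFull c n with K ≤? c n
  lastFull c n       | yes K≤ = inj₁ (n , ≤-refl , K≤ , λ n<j j≤n → contradiction j≤n (<⇒≱ n<j))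
  lastFull c zero    | no K≰  = inj₂ λ { z≤n → ≰⇒> K≰ }
  lastFull c (suc n) | no K≰ with lastFull c n
  ... | inj₁ (i , i≤n , K≤ , above) = inj₁ (i , m≤n⇒m≤1+n i≤n , K≤ , above′)
    where
    above′ : ∀ {j} → i < j → j ≤ suc n → c j < K
    above′ {j} i<j j≤1+n with j ≟ suc n
    ... | yes refl = ≰⇒> K≰
    ... | no  j≢   = above i<j (≤-pred (≤∧≢⇒< j≤1+n j≢))
  ... | inj₂ none = inj₂ none′
    where
    none′ : ∀ {j} → j ≤ suc n → c j < K
    none′ {j} j≤1+n with j ≟ suc n
    ... | yes refl = ≰⇒> K≰
    ... | no  j≢   = none (≤-pred (≤∧≢⇒< j≤1+n j≢))

  -- Leaving a loop on x by the letter not x uses up the gap j or j + 1 of p: while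
  -- the first run is incomplete, j is the length of the longest prefix seen;
  -- afterwards it is the largest index whose count exceeds k.
  exit : ∀ {c x} → Positive c → Loop c x → Dead c ⊎ ∃[ j ] j < ℓ × Moves c (not x) j × Drops c j
  exit {c} {x} pos loop with c b ≟ 0
  ... | yes cb≡0 with firstZero c b (Positive.head-pos pos) cb≡0
  ...   | j , j<b , 0<cj , eq = inj₂ (j , j<ℓ , (pj , 0<cj , <K) , drops-first {c} j<b 0<cj eq)
    where
    j<ℓ = <-trans j<b b<ℓ
    <K : c (suc j) < K
    <K = ≤-<-trans (≤-reflexive eq) (s≤s z≤n)
    pj : p j ≡ not x
    pj = ¬-not λ pj≡x → Loop⇒¬Moves {c} loop j<ℓ (pj≡x , 0<cj , <K)
  exit {c} {x} pos loop | no cb≢0 = result (lastFull c ℓ)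
    where
    open Positive pos
    0<cb = n≢0⇒n>0 cb≢0

    blocked : ∀ {j} → j < ℓ → 0 < c j → c (suc j) < K → p j ≢ x
    blocked j<ℓ 0<cj <K pj≡x = Loop⇒¬Moves {c} loop j<ℓ (pj≡x , 0<cj , <K)

    -- The letters at b - 1 and b differ, so `x` is one of them; with the counts at b and b + 1 both
    -- below `K`, that letter would move the state. Hence the largest saturated index is at least b.
    boundary-moves : c b < K → c (suc b) < K → ⊥
    boundary-moves b<K 1+b<K = pred-moves b refl
      where
      pred-moves : ∀ m → b ≡ m → ⊥
      pred-moves zero    b≡0   = <⇒≢ 0<b (sym b≡0)
      pred-moves (suc d) b≡1+d = pb≢a (begin
        p b      ≡⟨ ¬-not (blocked b<ℓ 0<cb 1+b<K) ⟩
        not x    ≡⟨ ¬-not (blocked (<-trans d<b b<ℓ) (pos-mono (<⇒≤ d<b) 0<cb) (subst (λ i → c i < K) b≡1+d b<K)) ⟨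
        p d      ≡⟨ p≡a d<b ⟩
        a        ∎)
        where
        open ≡-Reasoning
        d<b = ≤-reflexive (sym b≡1+d)

    result : (∃[ i ] i ≤ ℓ × K ≤ c i × (∀ {j} → i < j → j ≤ ℓ → c j < K)) ⊎ (∀ {j} → j ≤ ℓ → c j < K) →
             Dead c ⊎ ∃[ j ] j < ℓ × Moves c (not x) j × Drops c j
    result (inj₂ none) = ⊥-elim (boundary-moves (none (<⇒≤ b<ℓ)) (none b<ℓ))
    result (inj₁ (i , i≤ℓ , K≤ci , above)) with b ≤? i
    ... | no b≰i = ⊥-elim (boundary-moves (above (≰⇒> b≰i) (<⇒≤ b<ℓ)) (above (m≤n⇒m≤1+n (≰⇒> b≰i)) b<ℓ))
    ... | yes b≤i with i <? ℓ
    ...   | no i≮ℓ = inj₁ (i , i≤ℓ , K≤ci , λ i<j j≤ℓ → contradiction (<-≤-trans i<j j≤ℓ) i≮ℓ)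
    ...   | yes i<ℓ with c (suc i) ≟ 0
    ...     | yes eq = inj₁ (i , i≤ℓ , K≤ci , λ i<j _ → zero-mono i<j eq)
    ...     | no neq = inj₂ (i , i<ℓ , (pi , 0<ci , <K) , drops-last {c} b≤i (gapAt-true same i<ℓ) K≤ci <K)
      where
      0<ci = <-≤-trans (s≤s z≤n) K≤ci
      <K = above ≤-refl i<ℓ
      pi = ¬-not (blocked i<ℓ 0<ci <K)
      -- As the count at i + 1 is positive, the letter `p (suc i)` is blocked as well. Both letters
      -- then differ from `x`, and i + 1 is a gap.
      same : suc i < ℓ → p i ≡ p (suc i)
      same 1+i<ℓ = trans pi (sym (¬-not (blocked 1+i<ℓ (n≢0⇒n>0 neq) (above (n≤1+n (suc i)) 1+i<ℓ))))

  -- The number of coefficients bounds the degree plus one. `leading` ranges over all `d ≈ c`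
  -- because a loop returns to its state only up to `_≈_`.
  record Growth (c : State) : Set where
    field
      from    : ℕ
      coeffs  : List ℕ
      formula : ∀ n → count c (from + n) ≡ newton 0 coeffs n
      bounded : length coeffs ≤ potential c
      leading : ∀ {d e} → d ≈ c → Path e d → ∃[ j ] e ≤ j × 0 < coeffs ‼ j

  growth-dead : ∀ {c} → Dead c → Growth c
  growth-dead dead = record
    { from = 0 ; coeffs = [] ; formula = Dead⇒count≡0 0<k dead ; bounded = z≤n
    ; leading = λ d≈c path → contradiction path (Dead⇒¬Path 0<k (Dead-cong (≈-sym d≈c) dead)) }

  -- Along a loop the first difference of the count is the count of the exit state. Summation puts a
  -- constant term in front of that state's series, and the drop of the potential pays for the new
  -- coefficient.
  growth-loop : ∀ {c x j} → Loop c x → j < ℓ → Moves c (not x) j → Drops c j → Growth (step c (not x)) → Growth c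
  growth-loop {c} {x} {j} loop j<ℓ moves drops G = record
    { from = G.from ; coeffs = count c G.from ∷ G.coeffs ; formula = formula
    ; bounded = ≤-<-trans G.bounded (potential-< {c} j<ℓ (proj₁ moves) drops) ; leading = leading }
    where
    module G = Growth G
    formula : ∀ n → count c (G.from + n) ≡ newton 0 (count c G.from ∷ G.coeffs) n
    formula zero = trans (cong (count c) (+-identityʳ G.from))
      (sym (trans (cong₂ _+_ (*-identityʳ _) (newton-zero 0 G.coeffs)) (+-identityʳ _)))
    formula (suc n) = begin
      count c (G.from + suc n)                                      ≡⟨ cong (count c) (+-suc G.from n) ⟩
      count c (suc (G.from + n))                                    ≡⟨ count-loop (G.from + n) loop ⟩
      count c (G.from + n) + count (step c (not x)) (G.from + n)    ≡⟨ cong₂ _+_ (formula n) (G.formula n) ⟩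
      (count c G.from * 1 + newton 1 G.coeffs n) + newton 0 G.coeffs n
                                                                    ≡⟨ +-assoc (count c G.from * 1) _ _ ⟩
      count c G.from * 1 + (newton 1 G.coeffs n + newton 0 G.coeffs n)
                                                                    ≡⟨ cong (count c G.from * 1 +_) (newton-suc 0 G.coeffs n) ⟨
      newton 0 (count c G.from ∷ G.coeffs) (suc n) ∎
      where open ≡-Reasoning

    ¬loop : ∀ {d} → d ≈ c → ¬ Loop d (not x)
    ¬loop d≈c loop′ = Loop⇒¬Moves {c} (Loop-cong d≈c loop′) j<ℓ moves

    leading : ∀ {d e} → d ≈ c → Path e d → ∃[ i ] e ≤ i × 0 < (count c G.from ∷ G.coeffs) ‼ i
    -- The constant term is positive because an accepting state may follow its loop for all `G.from`
    -- letters.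
    leading d≈c (stop _ _ eq) = 0 , z≤n , ≤-trans
      (≤-reflexive (sym (cong indicator (dec-true (c ℓ ≟ k) (accept-cong d≈c eq)))))
      (≤-trans (count-loop-mono G.from 0 loop) (≤-reflexive (cong (count c) (+-identityʳ G.from))))
    leading {d} d≈c (y ◂ path) with y Bool.≟ x
    ... | yes refl = leading (λ j≤ℓ → ≃-trans (Loop⇒step≈ {d} {x} (Loop-cong (≈-sym d≈c) loop) j≤ℓ) (d≈c j≤ℓ)) path
    ... | no  y≢x with ¬-not y≢x
    ...   | refl with G.leading (step-cong (not x) d≈c) path
    ...     | i , e≤i , 0<ai = suc i , m≤n⇒m≤1+n e≤i , 0<ai
    leading d≈c (pivot y loop′ path) with y Bool.≟ x
    ... | no y≢x = ⊥-elim (¬loop d≈c (subst (Loop _) (¬-not y≢x) loop′))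
    ... | yes refl with G.leading (step-cong (not x) d≈c) path
    ...   | i , e≤i , 0<ai = suc i , s≤s e≤i , 0<ai

  -- Both letters move the state, so the two branches simply add up. Their series are shifted to the
  -- common start `M + N`, with one more letter for the branching itself; neither shifting nor
  -- adding destroys a positive coefficient.
  growth-split : ∀ {c} → (∀ x → ∃[ j ] j < ℓ × Moves c x j) → (∀ x → Growth (step c x)) → Growth c
  growth-split {c} moves G = record
    { from = suc (M + N) ; coeffs = as ⊕ bs
    ; formula = λ n → trans (cong₂ _+_ (eq₀ n) (eq₁ n)) (sym (newton-⊕ 0 as bs n))
    ; bounded = length-⊕ as bs
        (length-shiftBy N _ (≤-trans (Growth.bounded (G false)) (potential-step c false)))
        (length-shiftBy M _ (≤-trans (Growth.bounded (G true)) (potential-step c true)))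
    ; leading = leading }
    where
    open ≡-Reasoning
    M = Growth.from (G false)
    N = Growth.from (G true)
    as = shiftBy N (Growth.coeffs (G false))
    bs = shiftBy M (Growth.coeffs (G true))
    eq₀ : ∀ n → count (step c false) (M + N + n) ≡ newton 0 as n
    eq₀ n = begin
      count (step c false) (M + N + n)              ≡⟨ cong (count (step c false)) (+-assoc M N n) ⟩
      count (step c false) (M + (N + n))            ≡⟨ Growth.formula (G false) (N + n) ⟩
      newton 0 (Growth.coeffs (G false)) (N + n)    ≡⟨ newton-shiftBy N (Growth.coeffs (G false)) n ⟨
      newton 0 as n ∎
    eq₁ : ∀ n → count (step c true) (M + N + n) ≡ newton 0 bs n
    eq₁ n = begin
      count (step c true) (M + N + n)               ≡⟨ cong (λ m → count (step c true) (m + n)) (+-comm M N) ⟩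
      count (step c true) (N + M + n)               ≡⟨ cong (count (step c true)) (+-assoc N M n) ⟩
      count (step c true) (N + (M + n))             ≡⟨ Growth.formula (G true) (M + n) ⟩
      newton 0 (Growth.coeffs (G true)) (M + n)     ≡⟨ newton-shiftBy M (Growth.coeffs (G true)) n ⟨
      newton 0 bs n ∎
    ¬loop : ∀ {d x} → d ≈ c → ¬ Loop d x
    ¬loop {d} {x} d≈c loop with moves x
    ... | j , j<ℓ , mv = Loop⇒¬Moves {c} (Loop-cong d≈c loop) j<ℓ mv
    leading : ∀ {d e} → d ≈ c → Path e d → ∃[ i ] e ≤ i × 0 < (as ⊕ bs) ‼ i
    leading d≈c (stop _ loop _)  = ⊥-elim (¬loop d≈c loop)
    leading d≈c (pivot _ loop _) = ⊥-elim (¬loop d≈c loop)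
    leading d≈c (false ◂ path) with Growth.leading (G false) (step-cong false d≈c) path
    ... | i , e≤i , 0<ai = i , e≤i , <-≤-trans 0<ai (≤-trans (‼-shiftBy N _ i)
      (≤-trans (m≤m+n (as ‼ i) (bs ‼ i)) (≤-reflexive (sym (‼-⊕ as bs i)))))
    leading d≈c (true ◂ path) with Growth.leading (G true) (step-cong true d≈c) path
    ... | i , e≤i , 0<ai = i , e≤i , <-≤-trans 0<ai (≤-trans (‼-shiftBy M _ i)
      (≤-trans (m≤n+m (bs ‼ i) (as ‼ i)) (≤-reflexive (sym (‼-⊕ as bs i)))))

  -- Fuel makes the descent of `room` structural. A looping state that is not dead is left by its
  -- other letter, which moves it by `exit`.
  growth : ∀ fuel c → room c < fuel → Positive c → Growth c
  growth-looping : ∀ fuel c x → room c ≤ fuel → Positive c → Loop c x → Growth c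

  growth (suc fuel) c (s≤s r) pos with loop⊎moves c false | loop⊎moves c true
  ... | inj₁ loop | _         = growth-looping fuel c false r pos loop
  ... | inj₂ _    | inj₁ loop = growth-looping fuel c true r pos loop
  ... | inj₂ mv₀  | inj₂ mv₁  = growth-split moves
      λ x → growth fuel (step c x) (<-≤-trans (room-< {c} (proj₁ (proj₂ (moves x))) (proj₂ (proj₂ (moves x)))) r) (step-Positive x pos)
    where
    moves : ∀ x → ∃[ j ] j < ℓ × Moves c x j
    moves false = mv₀
    moves true  = mv₁
  growth-looping fuel c x r pos loop with exit pos loop
  ... | inj₁ dead = growth-dead dead
  ... | inj₂ (j , j<ℓ , mv , drops) = growth-loop loop j<ℓ mv drops
    (growth fuel (step c (not x)) (<-≤-trans (room-< {c} j<ℓ mv) r) (step-Positive (not x) pos))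

  -- The weights below b stand for the gaps 0, ..., b - 1, the others for b + 1, ..., ℓ. Since b is
  -- no gap, these are the gaps counted by `gaps 0 ℓ` together with the final gap ℓ.
  potential-initial : potential initial ≤ suc (gaps 0 ℓ)
  potential-initial = from (ℓ ∸ suc b) (m∸n+n≡m b<ℓ)
    where
    open ≤-Reasoning
    no-gap : gapAt b ≡ false
    no-gap = at b refl
      where
      at : ∀ i → b ≡ i → gapAt i ≡ false
      at zero    b≡0   = contradiction (sym b≡0) (<⇒≢ 0<b)
      at (suc i) b≡1+i rewrite dec-false (suc i ≟ ℓ) (<⇒≢ (subst (_< ℓ) b≡1+i b<ℓ)) =
        dec-false (p i Bool.≟ p (suc i)) λ eq → pb≢a (trans (cong p b≡1+i)
          (trans (sym eq) (p≡a (≤-reflexive (sym b≡1+i)))))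

    indicator-≤1 : ∀ x → indicator x ≤ 1
    indicator-≤1 true  = ≤-refl
    indicator-≤1 false = z≤n

    weight-≤1 : ∀ i → weight i 0 ≤ 1
    weight-≤1 i with does (i <? b)
    ... | true  = ≤-refl
    ... | false = ≤-trans (≤-reflexive (*-identityʳ _)) (indicator-≤1 (gapAt (suc i)))

    early : ∀ n → sumTo (λ i → weight i 0) n ≤ n
    early zero    = z≤n
    early (suc n) = ≤-trans (+-mono-≤ (early n) (weight-≤1 n)) (≤-reflexive (+-comm n 1))

    late : ∀ m → sumTo (λ i → weight i 0) (m + b) ≤ b + gaps (suc b) m
    late zero    = ≤-trans (early b) (m≤m+n b 0)
    late (suc m) = begin
      sumTo (λ i → weight i 0) (m + b) + weight (m + b) 0  ≤⟨ +-mono-≤ (late m) weight-late ⟩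
      b + gaps (suc b) m + indicator (gapAt (m + suc b))   ≡⟨ +-assoc b _ _ ⟩
      b + (gaps (suc b) m + indicator (gapAt (m + suc b)))
        ≡⟨ cong (λ v → b + (gaps (suc b) m + v)) (+-identityʳ _) ⟨
      b + (gaps (suc b) m + gaps (m + suc b) 1)            ≡⟨ cong (b +_) (gaps-+ (suc b) m 1) ⟨
      b + gaps (suc b) (m + 1)                             ≡⟨ cong (λ v → b + gaps (suc b) v) (+-comm m 1) ⟩
      b + gaps (suc b) (suc m) ∎
      where
      weight-late : weight (m + b) 0 ≤ indicator (gapAt (m + suc b))
      weight-late rewrite dec-false (m + b <? b) (≤⇒≯ (m≤n+m b m)) | +-suc m b = ≤-reflexive (*-identityʳ _)

    gaps-early : ∀ n i → n + i ≤ b → gaps i n ≡ n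
    gaps-early zero    i _ = refl
    gaps-early (suc n) i q = cong₂ (λ u v → indicator u + v) (gap-early i (≤-trans (s≤s (m≤n+m i n)) q))
      (gaps-early n (suc i) (≤-trans (≤-reflexive (+-suc n i)) q))
      where
      gap-early : ∀ i → i < b → gapAt i ≡ true
      gap-early zero    _ = refl
      gap-early (suc i) i<b = gapAt-true (λ _ → trans (p≡a (<⇒≤ i<b)) (sym (p≡a i<b))) (<⇒≤ (<-trans i<b b<ℓ))

    from : ∀ m → m + suc b ≡ ℓ → potential initial ≤ suc (gaps 0 ℓ)
    from m eq = begin
      sumTo (λ i → weight i 0) ℓ            ≡⟨ cong (sumTo (λ i → weight i 0)) (trans (sym eq) (+-suc m b)) ⟩
      sumTo (λ i → weight i 0) (suc m + b)  ≤⟨ late (suc m) ⟩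
      b + gaps (suc b) (suc m)              ≡⟨ cong (λ v → b + gaps (suc b) v) (+-comm 1 m) ⟩
      b + gaps (suc b) (m + 1)              ≡⟨ cong (b +_) (gaps-+ (suc b) m 1) ⟩
      b + (gaps (suc b) m + gaps (m + suc b) 1)
        ≤⟨ +-monoʳ-≤ b (+-monoʳ-≤ (gaps (suc b) m) (≤-trans (≤-reflexive (+-identityʳ _)) (indicator-≤1 _))) ⟩
      b + (gaps (suc b) m + 1)              ≡⟨ cong (b +_) (+-comm _ 1) ⟩
      b + suc (gaps (suc b) m)              ≡⟨ +-suc b _ ⟩
      suc (b + gaps (suc b) m)
        ≡⟨ cong₂ (λ u v → suc (u + v)) (gaps-early b 0 (≤-reflexive (+-identityʳ b)))
             (cong (λ x → indicator x + gaps (suc b) m) no-gap) ⟨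
      suc (gaps 0 b + gaps b (suc m))       ≡⟨ cong (λ i → suc (gaps 0 b + gaps i (suc m))) (+-identityʳ b) ⟨
      suc (gaps 0 b + gaps (b + 0) (suc m)) ≡⟨ cong suc (gaps-+ 0 b (suc m)) ⟨
      suc (gaps 0 (b + suc m))
        ≡⟨ cong (λ n → suc (gaps 0 n)) (trans (+-suc b m) (trans (cong suc (+-comm b m)) (trans (sym (+-suc m b)) eq))) ⟩
      suc (gaps 0 ℓ) ∎

-- Words attaining the maximal degree

-- Maximality is stated so that `leftEnd` is vacuous at the start of the word and `rightEnd` at its
-- end.
record RunAt (p : ℕ → Bool) (ℓ start len : ℕ) : Set where
  field
    letter   : Bool
    nonempty : 0 < len
    inside   : len + start ≤ ℓ
    constant : ∀ {t} → t < len → p (t + start) ≡ letter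
    leftEnd  : ∀ {i} → suc i ≡ start → p i ≢ letter
    rightEnd : len + start < ℓ → p (len + start) ≢ letter

module Paths (p : ℕ → Bool) (ℓ k : ℕ) where
  open Automaton p ℓ k

  -- Repeating `x` must reach a loop, since every move lowers `room`.
  saturate : ∀ {e} (I : State → Set) x → (∀ {c} → I c → I (step c x)) →
    (∀ {c} → I c → Loop c x → Path e c) → ∀ {c} → I c → Path e c
  saturate {e} I x keep use {c} = go (suc (room c)) ≤-refl
    where
    go : ∀ fuel {c} → room c < fuel → I c → Path e c
    go (suc fuel) {c} (s≤s r) inv with loop⊎moves c x
    ... | inj₁ loop            = use inv loop
    ... | inj₂ (j , j<ℓ , mv) = x ◂ go fuel (<-≤-trans (room-< {c} j<ℓ mv) r) (keep inv)

  -- At a gap the letter other than `p i` is repeated until it loops, and `p i` leaves this loop;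
  -- elsewhere `p i` is read at once.
  advance : ∀ {e} (I J : State → Set) i →
    (gapAt i ≡ true → ∀ {c} → I c → I (step c (not (p i)))) →
    (∀ {c} → I c → J (step c (p i))) →
    (∀ {c} → J c → Path e c) → ∀ {c} → I c → Path (indicator (gapAt i) + e) c
  advance {e} I J i keep read use inv with gapAt i
  ... | false = p i ◂ use (read inv)
  ... | true  = saturate I (not (p i)) (keep refl)
    (λ {c} inv′ loop → pivot (not (p i)) loop
      (subst (λ x → Path e (step c x)) (sym (not-involutive (p i))) (use (read inv′)))) inv

  travel : ∀ {e} (I : ℕ → State → Set) start n t →
    (∀ {u} → u < n + t → gapAt (u + start) ≡ true → ∀ {c} → I u c → I u (step c (not (p (u + start))))) →
    (∀ {u} → u < n + t → ∀ {c} → I u c → I (suc u) (step c (p (u + start)))) →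
    (∀ {c} → I (n + t) c → Path e c) → ∀ {c} → I t c → Path (gaps (t + start) n + e) c
  travel I start zero    t keep read use inv = use inv
  travel {e} I start (suc n) t keep read use {c} inv =
    subst (λ d → Path d c) (sym (+-assoc (indicator (gapAt (t + start))) _ e))
      (advance (I t) (I (suc t)) (t + start) (keep (m<n+m t (s≤s z≤n))) (read (m<n+m t (s≤s z≤n)))
        (travel I start n (suc t)
          (λ {u} u< → keep (subst (u <_) (+-suc n t) u<))
          (λ {u} u< → read (subst (u <_) (+-suc n t) u<))
          (λ {d} inv′ → use (subst (λ m → I m d) (+-suc n t) inv′)))
        inv)

  -- A letter different from the last one of p creates no occurrence of p. This final loop is the
  -- gap ℓ that `gaps 0 ℓ` omits.
  finish : 0 < ℓ → ∀ {c} → c ℓ ≡ k → Path 0 c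
  finish 0<ℓ = from ℓ refl
    where
    from : ∀ m → m ≡ ℓ → ∀ {c} → c ℓ ≡ k → Path 0 c
    from zero    eq = contradiction eq (<⇒≢ 0<ℓ)
    from (suc i) eq = saturate (λ c → c ℓ ≡ k) (not (p i))
      (λ {c} cℓ≡k → subst (λ m → step c (not (p i)) m ≡ k) eq
        (trans (step-miss {c} (not-¬ refl)) (trans (cong c eq) cℓ≡k)))
      (λ cℓ≡k loop → stop (not (p i)) loop cℓ≡k)

  -- `v` is 1 before the stretched run and k after it. As no longer prefix has been seen, the next
  -- letter of p carries `v` over exactly.
  Top : ℕ → ℕ → State → Set
  Top v i c = c i ≡ v × Above i c

  -- At a gap, the letter different from `p i` differs from the preceding letter of p too, so the
  -- current count stays exact.
  Top-gap : ∀ {v i} → i < ℓ → gapAt i ≡ true → ∀ {c} → Top v i c → Top v i (step c (not (p i)))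
  Top-gap {i = zero} i<ℓ gap {c} (eq , above) = eq , Above-step {c} (λ _ → not-¬ refl) above
  Top-gap {i = suc i} i<ℓ gap {c} (eq , above) =
    trans (step-miss {c} (λ e → not-¬ refl (trans (sym (gapAt-same gap i<ℓ)) e))) eq , Above-step {c} (λ _ → not-¬ refl) above

  Top-read : ∀ {v i} → i < ℓ → ∀ {c} → Top v i c → Top v (suc i) (step c (p i))
  Top-read i<ℓ {c} (eq , above) =
    trans (step-hit {c} refl) (cong₂ _+_ (above ≤-refl i<ℓ) eq) , Above-step-suc {c} above

  travel-Top : ∀ {e v} start n → n + start ≤ ℓ → (∀ {c} → Top v (n + start) c → Path e c) →
    ∀ {c} → Top v start c → Path (gaps start n + e) c
  travel-Top {v = v} start n n≤ use = travel (λ u → Top v (u + start)) start n 0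
    (λ u< → Top-gap (bound u<)) (λ u< → Top-read (bound u<))
    (λ {c} inv → use (subst (λ m → Top v (m + start) c) (+-identityʳ n) inv))
    where
    bound : ∀ {u} → u < n + 0 → u + start < ℓ
    bound u< = <-≤-trans (+-monoˡ-< start (subst (_ <_) (+-identityʳ n) u<)) n≤

  -- A run of length len stretched to s + len letters contains C(s + len, len) copies
  -- of itself.
  module Stretch {start len s : ℕ} (run : RunAt p ℓ start len) (binomial : (len + s) C len ≡ k) where
    open RunAt run

    binomial′ : (s + len) C len ≡ k
    binomial′ = trans (cong (_C len) (+-comm s len)) binomial

    Binomial : ℕ → State → Set
    Binomial m c = (∀ {t} → t ≤ len → c (t + start) ≡ m C t) × Above (len + start) c

    Top⇒Binomial : ∀ {c} → Top 1 start c → Binomial 0 c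
    Top⇒Binomial {c} (eq , above) = counts , λ i<j → above (≤-<-trans (m≤n+m start len) i<j)
      where
      counts : ∀ {t} → t ≤ len → c (t + start) ≡ 0 C t
      counts {zero}  _    = eq
      counts {suc t} t<len = above (m<n+m start (s≤s z≤n)) (≤-trans (+-monoˡ-≤ start t<len) inside)

    -- Pascal's rule. By maximality of the run, its letter neither alters the count at `start` nor
    -- extends a prefix beyond the run.
    Binomial-read : ∀ {m c} → Binomial m c → Binomial (suc m) (step c letter)
    Binomial-read {m} {c} (counts , above) = counts′ , Above-step {c} rightEnd above
      where
      unchanged : ∀ {i} → i ≡ start → step c letter i ≡ c i
      unchanged {zero}  _  = refl
      unchanged {suc i} eq = step-miss {c} (leftEnd eq)
      counts′ : ∀ {t} → t ≤ len → step c letter (t + start) ≡ suc m C t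
      counts′ {zero}  _     = trans (unchanged refl) (counts z≤n)
      counts′ {suc t} t<len = trans (step-hit {c} (constant t<len))
        (trans (cong₂ _+_ (counts t<len) (counts (<⇒≤ t<len)))
          (trans (+-comm (m C suc t) (m C t)) (sym (pascal m t))))

    Binomial-reads : ∀ {e} n m → (∀ {c} → Binomial (n + m) c → Path e c) → ∀ {c} → Binomial m c → Path e c
    Binomial-reads zero    m use inv = use inv
    Binomial-reads (suc n) m use inv =
      letter ◂ Binomial-reads n (suc m) (λ {c} inv′ → use (subst (λ j → Binomial j c) (+-suc n m) inv′)) (Binomial-read inv)

    no-gap-before : ∀ {i} → suc i ≡ start → gapAt start ≢ true
    no-gap-before {i} refl gap = leftEnd refl (trans (gapAt-same gap start<ℓ) (constant nonempty))
      where start<ℓ = <-≤-trans (m<n+m start nonempty) inside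

    letter≢ : ∀ {t u} → t < len → u < len → p (t + start) ≢ not (p (u + start))
    letter≢ t<len u<len eq = not-¬ (trans (constant t<len) (sym (constant u<len))) eq

    rest : ℕ
    rest = ℓ ∸ (len + start)

    gaps-total : gaps 0 start + (gaps start len + gaps (len + start) rest) ≡ gaps 0 ℓ
    gaps-total = begin
      gaps 0 start + (gaps start len + gaps (len + start) rest)
        ≡⟨ cong (gaps 0 start +_) (gaps-+ start len rest) ⟨
      gaps 0 start + gaps start (len + rest)
        ≡⟨ cong (λ i → gaps 0 start + gaps i (len + rest)) (+-identityʳ start) ⟨
      gaps 0 start + gaps (start + 0) (len + rest)
        ≡⟨ gaps-+ 0 start (len + rest) ⟨
      gaps 0 (start + (len + rest))
        ≡⟨ cong (gaps 0) (trans (sym (+-assoc start len rest)) (trans (cong (_+ rest) (+-comm start len)) (m+[n∸m]≡n inside))) ⟩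
      gaps 0 ℓ ∎
      where open ≡-Reasoning

    initial-Top : Top 1 0 initial
    initial-Top = refl , λ { {suc j} _ _ → refl }

    start≤ℓ : start ≤ ℓ
    start≤ℓ = ≤-trans (m≤n+m start len) inside

    from-start : ∀ {e} → (∀ {c} → Top 1 start c → Path e c) → Path (gaps 0 start + e) initial
    from-start use = travel-Top 0 start (subst (_≤ ℓ) (sym (+-identityʳ start)) start≤ℓ)
      (λ {c} inv → use (subst (λ i → Top 1 i c) (+-identityʳ start) inv)) initial-Top

    0<ℓ : 0 < ℓ
    0<ℓ = <-≤-trans nonempty (≤-trans (m≤m+n len start) inside)

    to-end : ∀ {c} → Top k (len + start) c → Path (gaps (len + start) rest) c
    to-end {c} inv = subst (λ e → Path e c) (+-identityʳ _)
      (travel-Top (len + start) rest (≤-reflexive end)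
        (λ {d} (dℓ , _) → finish 0<ℓ (subst (λ j → d j ≡ k) end dℓ)) inv)
      where
      end : rest + (len + start) ≡ ℓ
      end = m∸n+n≡m inside

    -- Gaps inside the run are used while its first `len` letters are read; the `s` surplus letters
    -- follow. The opposite letter could only disturb the count at `start`: for `start = 0` that
    -- count never changes, and for `len = 1` the only candidate, `start`, is no gap unless it is 0.
    path-gapped-first : start ≡ 0 ⊎ len ≡ 1 → Path (gaps 0 ℓ) initial
    path-gapped-first first = subst (λ e → Path e initial) gaps-total
      (from-start λ top → travel Binomial start len 0 keep read
        (λ {c} inv → Binomial-reads s len done (subst (λ m → Binomial m c) (+-identityʳ len) inv))
        (Top⇒Binomial top))
      where
      <len : ∀ {u} → u < len + 0 → u < len
      <len = subst (_ <_) (+-identityʳ len)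

      done : ∀ {c} → Binomial (s + len) c → Path (gaps (len + start) rest) c
      done {c} (counts , above) = to-end (trans (counts ≤-refl) binomial′ , above)

      read : ∀ {u} → u < len + 0 → ∀ {c} → Binomial u c → Binomial (suc u) (step c (p (u + start)))
      read u< {c} inv = subst (λ x → Binomial _ (step c x)) (sym (constant (<len u<))) (Binomial-read inv)

      gap⇒start≡0 : ∀ {u i} → i ≡ start → u < len → gapAt (u + start) ≡ true → i ≡ 0
      gap⇒start≡0 {i = zero} _ _ _ = refl
      gap⇒start≡0 {zero} {suc i} eq _ gap = contradiction gap (no-gap-before eq)
      gap⇒start≡0 {suc u} {suc i} eq u<len gap = [ trans eq
        , (λ len≡1 → contradiction (subst (suc u <_) len≡1 u<len) λ { (s≤s ()) }) ]′ first

      keep : ∀ {u} → u < len + 0 → gapAt (u + start) ≡ true → ∀ {c} → Binomial u c → Binomial u (step c (not (p (u + start))))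
      keep {u} u< gap {c} (counts , above) = counts′ , λ i<j → above′ (<-trans (+-monoˡ-< start u<len) i<j)
        where
        u<len = <len u<
        start≡0 = gap⇒start≡0 refl u<len gap
        counts′ : ∀ {t} → t ≤ len → step c (not (p (u + start))) (t + start) ≡ u C t
        counts′ {zero} _ = trans (unchanged start≡0) (counts z≤n)
          where
          unchanged : ∀ {i} → i ≡ 0 → step c (not (p (u + start))) i ≡ c i
          unchanged refl = refl
        counts′ {suc t} t<len = trans (step-miss {c} (letter≢ t<len u<len)) (counts t<len)
        -- After `u` letters of the run, C(u, t) = 0 for t > u, so no prefix longer than `u + start`
        -- has been seen.
        above-u : Above (u + start) c
        above-u {j} u<j j≤ℓ with j ≤? len + start
        ... | no j≰ = above (≰⇒> j≰) j≤ℓ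
        ... | yes j≤ = begin
          c j                    ≡⟨ cong c (m∸n+n≡m start≤j) ⟨
          c (j ∸ start + start)  ≡⟨ counts (m≤n+o⇒m∸o≤n j≤) ⟩
          u C (j ∸ start)        ≡⟨ k>n⇒nCk≡0 (m+n≤o⇒m≤o∸n (suc u) u<j) ⟩
          0 ∎
          where
          open ≡-Reasoning
          start≤j = ≤-trans (m≤n+m start u) (<⇒≤ u<j)
          m≤n+o⇒m∸o≤n : j ≤ len + start → j ∸ start ≤ len
          m≤n+o⇒m∸o≤n q = ≤-trans (∸-monoˡ-≤ start q) (≤-reflexive (m+n∸n≡m len start))
        above′ : Above (u + start) (step c (not (p (u + start))))
        above′ = Above-step {c} (λ _ → not-¬ refl) above-u

    -- The t-th gap inside the last run spoils the counts of the first t prefixes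
    -- ending in that run, but these can no longer be completed.
    path-gapped-last : ∀ {i} → suc i ≡ start → len + start ≡ ℓ → Path (gaps 0 ℓ) initial
    path-gapped-last {i} 1+i≡start end = subst (λ e → Path e initial) total
      -- The surplus letters are read before any gap of the run is used: later only the counts from
      -- the current index on are controlled, which suffices when just the `len` letters of the run
      -- remain.
      (from-start λ top → Binomial-reads s 0 (λ (counts , _) →
        travel Tail start len 0 keep read done λ {t} _ t≤len → counts t≤len) (Top⇒Binomial top))
      where
      Tail : ℕ → State → Set
      Tail m c = ∀ {t} → m ≤ t → t ≤ len → c (t + start) ≡ (s + m) C t

      <len : ∀ {u} → u < len + 0 → u < len
      <len = subst (_ <_) (+-identityʳ len)

      total : gaps 0 start + (gaps start len + 0) ≡ gaps 0 ℓ
      total = trans (cong (λ m → gaps 0 start + (gaps start len + gaps (len + start) m))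
        (sym (trans (cong (ℓ ∸_) end) (n∸n≡0 ℓ)))) gaps-total

      read : ∀ {u} → u < len + 0 → ∀ {c} → Tail u c → Tail (suc u) (step c (p (u + start)))
      read {u} u< {c} tail {suc t} (s≤s u≤t) t<len = begin
        step c (p (u + start)) (suc t + start)
          ≡⟨ step-hit {c} (trans (constant t<len) (sym (constant (<len u<)))) ⟩
        c (suc t + start) + c (t + start)  ≡⟨ cong₂ _+_ (tail (m≤n⇒m≤1+n u≤t) t<len) (tail u≤t (<⇒≤ t<len)) ⟩
        (s + u) C suc t + (s + u) C t      ≡⟨ +-comm ((s + u) C suc t) _ ⟩
        (s + u) C t + (s + u) C suc t      ≡⟨ pascal (s + u) t ⟨
        suc (s + u) C suc t                ≡⟨ cong (_C suc t) (+-suc s u) ⟨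
        (s + suc u) C suc t                ∎
        where open ≡-Reasoning

      keep : ∀ {u} → u < len + 0 → gapAt (u + start) ≡ true → ∀ {c} → Tail u c → Tail u (step c (not (p (u + start))))
      keep {zero}  u< gap = contradiction gap (no-gap-before 1+i≡start)
      keep {suc u} u< gap {c} tail {suc t} u≤t t<len = trans (step-miss {c} (letter≢ t<len (<len u<))) (tail u≤t t<len)

      done : ∀ {c} → Tail (len + 0) c → Path 0 c
      done {c} tail = finish 0<ℓ (begin
        c ℓ                    ≡⟨ cong c end ⟨
        c (len + start)        ≡⟨ tail (≤-reflexive (+-identityʳ len)) ≤-refl ⟩
        (s + (len + 0)) C len  ≡⟨ cong (λ m → (s + m) C len) (+-identityʳ len) ⟩
        (s + len) C len        ≡⟨ binomial′ ⟩
        k                      ∎)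
        where open ≡-Reasoning

    path-stretched : (start ≡ 0 ⊎ len ≡ 1) ⊎ len + start ≡ ℓ → Path (gaps 0 ℓ) initial
    path-stretched (inj₁ first) = path-gapped-first first
    path-stretched (inj₂ end)   = at start refl
      where
      at : ∀ i → i ≡ start → Path (gaps 0 ℓ) initial
      at zero    eq = path-gapped-first (inj₁ (sym eq))
      at (suc i) eq = path-gapped-last eq end

-- Occurrences

module _ {A : Set} {P : A → Set} (P? : Decidable P) where

  number : List A → ℕ
  number xs = length (filter P? xs)

  number-∷ : ∀ x xs → number (x ∷ xs) ≡ indicator (does (P? x)) + number xs
  number-∷ x xs with does (P? x)
  ... | true  = refl
  ... | false = refl

  number-++ : ∀ xs ys → number (xs ++ ys) ≡ number xs + number ys
  number-++ xs ys = trans (cong length (filter-++ P? xs ys)) (length-++ (filter P? xs))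

  number-none : ∀ xs → (∀ x → ¬ P x) → number xs ≡ 0
  number-none []       none = refl
  number-none (x ∷ xs) none = trans (number-∷ x xs)
    (cong₂ _+_ (cong indicator (dec-false (P? x) (none x))) (number-none xs none))

number-≐ : ∀ {A : Set} {P Q : A → Set} (P? : Decidable P) (Q? : Decidable Q) →
  (∀ {x} → P x → Q x) → (∀ {x} → Q x → P x) → ∀ xs → number P? xs ≡ number Q? xs
number-≐ P? Q? P⇒Q Q⇒P xs = cong length (filter-≐ P? Q? (P⇒Q , Q⇒P) xs)

number-map : ∀ {A B : Set} {P : B → Set} (P? : Decidable P) (f : A → B) xs →
  number P? (map f xs) ≡ number (P? ∘ f) xs
number-map P? f []       = refl
number-map P? f (x ∷ xs) = trans (number-∷ P? (f x) (map f xs))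
  (trans (cong (indicator (does (P? (f x))) +_) (number-map P? f xs)) (sym (number-∷ (P? ∘ f) x xs)))

number-cartesian : ∀ {A B C : Set} {P : C → Set} (P? : Decidable P) (f : A → B → C) x xs ys →
  number P? (cartesianProductWith f (x ∷ xs) ys) ≡ number (P? ∘ f x) ys + number P? (cartesianProductWith f xs ys)
number-cartesian P? f x xs ys = trans (number-++ P? (map (f x) ys) _) (cong (_+ _) (number-map P? (f x) ys))

Nonzero : ∀ {n} → Fin (suc n) → Set
Nonzero i = i ≢ zero

number-nonzero : ∀ {n} m {Q : Vec (Fin (suc n)) m → Set} (Q? : Decidable Q) → (∀ {v} → Q v → All Nonzero v) →
  number Q? (vectors (allFin (suc n)) m) ≡ number (Q? ∘ Vec.map suc) (vectors (allFin n) m)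
number-nonzero-tail : ∀ {n} m {Q : Vec (Fin (suc n)) (suc m) → Set} (Q? : Decidable Q) ys →
  (∀ {y v} → Q (suc y ∷ v) → All Nonzero v) →
  number Q? (cartesianProductWith _∷_ (map suc ys) (vectors (allFin (suc n)) m)) ≡
  number (Q? ∘ Vec.map suc) (cartesianProductWith _∷_ ys (vectors (allFin n) m))

number-nonzero zero Q? nonzero = trans (number-∷ Q? [] []) (sym (number-∷ (Q? ∘ Vec.map suc) [] []))
number-nonzero {n} (suc m) Q? nonzero = begin
  number Q? (vectors (allFin (suc n)) (suc m))
    ≡⟨ number-cartesian Q? _∷_ zero (tabulate suc) vs ⟩
  number (Q? ∘ (zero ∷_)) vs + number Q? (cartesianProductWith _∷_ (tabulate suc) vs)
    ≡⟨ cong₂ _+_ (number-none (Q? ∘ (zero ∷_)) vs (λ v q → All.head (nonzero q) refl))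
         (cong (λ ys → number Q? (cartesianProductWith _∷_ ys vs)) (sym (map-tabulate id suc))) ⟩
  number Q? (cartesianProductWith _∷_ (map suc (allFin n)) vs)
    ≡⟨ number-nonzero-tail m Q? (allFin n) (All.tail ∘ nonzero) ⟩
  number (Q? ∘ Vec.map suc) (vectors (allFin n) (suc m)) ∎
  where
  open ≡-Reasoning
  vs = vectors (allFin (suc n)) m

number-nonzero-tail m Q? []       nonzero = refl
number-nonzero-tail m Q? (y ∷ ys) nonzero = trans (number-cartesian Q? _∷_ (suc y) (map suc ys) _)
  (trans (cong₂ _+_ (number-nonzero m (Q? ∘ (suc y ∷_)) nonzero) (number-nonzero-tail m Q? ys nonzero))
    (sym (number-cartesian (Q? ∘ Vec.map suc) _∷_ y ys _)))

All<-suc⁺ : ∀ {m n} {i : Fin n} {v : Vec (Fin n) m} → All (i Fin.<_) v → All (suc i Fin.<_) (Vec.map suc v)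
All<-suc⁺ []       = []
All<-suc⁺ (q ∷ qs) = s≤s q ∷ All<-suc⁺ qs

All<-suc⁻ : ∀ {m n} {i : Fin n} (v : Vec (Fin n) m) → All (suc i Fin.<_) (Vec.map suc v) → All (i Fin.<_) v
All<-suc⁻ []      []           = []
All<-suc⁻ (_ ∷ v) (s≤s q ∷ qs) = q ∷ All<-suc⁻ v qs

AllPairs<-suc⁺ : ∀ {m n} {v : Vec (Fin n) m} → AllPairs Fin._<_ v → AllPairs Fin._<_ (Vec.map suc v)
AllPairs<-suc⁺ []       = []
AllPairs<-suc⁺ (q ∷ qs) = All<-suc⁺ q ∷ AllPairs<-suc⁺ qs

AllPairs<-suc⁻ : ∀ {m n} (v : Vec (Fin n) m) → AllPairs Fin._<_ (Vec.map suc v) → AllPairs Fin._<_ v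
AllPairs<-suc⁻ []      []       = []
AllPairs<-suc⁻ (_ ∷ v) (q ∷ qs) = All<-suc⁻ v q ∷ AllPairs<-suc⁻ v qs

0<-all : ∀ {m n} (v : Vec (Fin n) m) → All (zero {n} Fin.<_) (Vec.map suc v)
0<-all []      = []
0<-all (_ ∷ v) = s≤s z≤n ∷ 0<-all v

lookup-suc : ∀ {m n} (x : Bool) (w : Word n) (v : Vec (Fin n) m) →
  Vec.map (lookup (x ∷ w)) (Vec.map suc v) ≡ Vec.map (lookup w) v
lookup-suc x w v = sym (Vec.map-∘ (lookup (x ∷ w)) suc v)

<⇒Nonzero : ∀ {n} {i j : Fin (suc n)} → i Fin.< j → Nonzero j
<⇒Nonzero {j = zero}  ()
<⇒Nonzero {j = suc j} _ ()

-- Split by the first index. If it is 0, the first letters must agree; if not, the increasing order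
-- keeps all indices away from 0.
occurrences-∷ : ∀ {ℓ n} a (p : Word ℓ) x (w : Word n) → occurrences (a ∷ p) (x ∷ w) ≡
  occurrences (a ∷ p) w + (if does (a Bool.≟ x) then occurrences p w else 0)
occurrences-∷ {ℓ} {n} a p x w = begin
  number Q? (vectors (allFin (suc n)) (suc ℓ))
    ≡⟨ number-cartesian Q? _∷_ zero (tabulate suc) vs ⟩
  number (Q? ∘ (zero ∷_)) vs + number Q? (cartesianProductWith _∷_ (tabulate suc) vs)
    ≡⟨ +-comm (number (Q? ∘ (zero ∷_)) vs) _ ⟩
  number Q? (cartesianProductWith _∷_ (tabulate suc) vs) + number (Q? ∘ (zero ∷_)) vs
    ≡⟨ cong₂ _+_ later (first (a Bool.≟ x)) ⟩
  occurrences (a ∷ p) w + (if does (a Bool.≟ x) then occurrences p w else 0) ∎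
  where
  open ≡-Reasoning
  Q? = isOccurrence? (a ∷ p) (x ∷ w)
  vs = vectors (allFin (suc n)) ℓ

  later : number Q? (cartesianProductWith _∷_ (tabulate suc) vs) ≡ occurrences (a ∷ p) w
  later = begin
    number Q? (cartesianProductWith _∷_ (tabulate suc) vs)
      ≡⟨ cong (λ ys → number Q? (cartesianProductWith _∷_ ys vs)) (sym (map-tabulate id suc)) ⟩
    number Q? (cartesianProductWith _∷_ (map suc (allFin n)) vs)
      ≡⟨ number-nonzero-tail ℓ Q? (allFin n) (λ { ((q ∷ _) , _) → All.map <⇒Nonzero q }) ⟩
    number (Q? ∘ Vec.map suc) (vectors (allFin n) (suc ℓ))
      ≡⟨ number-≐ (Q? ∘ Vec.map suc) (isOccurrence? (a ∷ p) w)
           (λ {v} (q , eq) → AllPairs<-suc⁻ v q , trans (sym (lookup-suc x w v)) eq)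
           (λ {v} (q , eq) → AllPairs<-suc⁺ q , trans (lookup-suc x w v) eq)
           (vectors (allFin n) (suc ℓ)) ⟩
    occurrences (a ∷ p) w ∎

  first : (a≟x : Dec (a ≡ x)) → number (Q? ∘ (zero ∷_)) vs ≡ (if does a≟x then occurrences p w else 0)
  first (no a≢x)   = number-none (Q? ∘ (zero ∷_)) vs (λ v (_ , eq) → a≢x (sym (Vec.∷-injectiveˡ eq)))
  first (yes refl) = trans
    (number-nonzero ℓ (Q? ∘ (zero ∷_)) (λ { ((q ∷ _) , _) → All.map <⇒Nonzero q }))
    (number-≐ (Q? ∘ (zero ∷_) ∘ Vec.map suc) (isOccurrence? p w)
      (λ { {v} ((_ ∷ q) , eq) → AllPairs<-suc⁻ v q , trans (sym (lookup-suc x w v)) (Vec.∷-injectiveʳ eq) })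
      (λ {v} (q , eq) → (0<-all v ∷ AllPairs<-suc⁺ q) , cong (x ∷_) (trans (lookup-suc x w v) eq))
      (vectors (allFin n) ℓ))

letterAt : ∀ {ℓ} → Word ℓ → ℕ → Bool
letterAt []      _       = false
letterAt (a ∷ p) zero    = a
letterAt (a ∷ p) (suc i) = letterAt p i

-- The number of occurrences of p in a word u w, when u leads to the state c and
-- q = p: an occurrence of p splits into a prefix in u and a suffix in w.
weigh : ∀ {m n} → (ℕ → ℕ) → Word m → Word n → ℕ
weigh c []      w = c 0
weigh c (a ∷ q) w = c 0 * occurrences (a ∷ q) w + weigh (c ∘ suc) q w

weigh-cong : ∀ {m n} {c d : ℕ → ℕ} (q : Word m) (w : Word n) → c ≗ d → weigh c q w ≡ weigh d q w
weigh-cong []      w c≗d = c≗d 0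
weigh-cong (a ∷ q) w c≗d =
  cong₂ (λ u v → u * occurrences (a ∷ q) w + v) (c≗d 0) (weigh-cong q w (c≗d ∘ suc))

-- This is `step` with an amount `u` entering at index 0, contributed by the letter before `q`.
-- Induction on `q` needs it; `u = 0` gives back `step`.
inflow : ∀ {m} → ℕ → Word m → (ℕ → ℕ) → Bool → ℕ → ℕ
inflow u q c x zero    = c 0 + u
inflow u q c x (suc j) = c (suc j) + (if does (letterAt q j Bool.≟ x) then c j else 0)

-- Double counting: the letter `x` may be counted as the last of the part already read or as the
-- first of the part to come.
weigh-inflow : ∀ {m n} u c (q : Word m) x (w : Word n) →
  weigh (inflow u q c x) q w ≡ u * occurrences q w + weigh c q (x ∷ w)
weigh-inflow u c []      x w = trans (+-comm (c 0) u) (cong (_+ c 0) (sym (*-identityʳ u)))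
weigh-inflow u c (a ∷ q) x w = begin
  (c 0 + u) * o + weigh (inflow u (a ∷ q) c x ∘ suc) q w
    ≡⟨ cong ((c 0 + u) * o +_) (weigh-cong q w λ { zero → refl ; (suc j) → refl }) ⟩
  (c 0 + u) * o + weigh (inflow (if does (a Bool.≟ x) then c 0 else 0) q (c ∘ suc) x) q w
    ≡⟨ cong ((c 0 + u) * o +_) (weigh-inflow (if does (a Bool.≟ x) then c 0 else 0) (c ∘ suc) q x w) ⟩
  (c 0 + u) * o + ((if does (a Bool.≟ x) then c 0 else 0) * occurrences q w + r)
    ≡⟨ cong (λ v → (c 0 + u) * o + (v + r)) (if-* (does (a Bool.≟ x))) ⟩
  (c 0 + u) * o + (c 0 * o′ + r)
    ≡⟨ solve 5 (λ c u o o′ r → (c :+ u) :* o :+ (c :* o′ :+ r) := u :* o :+ (c :* (o :+ o′) :+ r)) refl (c 0) u o o′ r ⟩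
  u * o + (c 0 * (o + o′) + r)
    ≡⟨ cong (λ v → u * o + (c 0 * v + r)) (occurrences-∷ a q x w) ⟨
  u * o + (c 0 * occurrences (a ∷ q) (x ∷ w) + r) ∎
  where
  open ≡-Reasoning
  open ℕ.+-*-Solver
  o = occurrences (a ∷ q) w
  o′ = if does (a Bool.≟ x) then occurrences q w else 0
  r = weigh (c ∘ suc) q (x ∷ w)
  if-* : ∀ b → (if b then c 0 else 0) * occurrences q w ≡ c 0 * (if b then occurrences q w else 0)
  if-* true  = refl
  if-* false = sym (*-zeroʳ (c 0))

weigh-zero : ∀ {m n} (q : Word m) (w : Word n) → weigh (λ _ → 0) q w ≡ 0
weigh-zero []      w = refl
weigh-zero (a ∷ q) w = weigh-zero q w

weigh-initial : ∀ {m n} (q : Word m) (w : Word n) → weigh initial q w ≡ occurrences q w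
weigh-initial []      w = refl
weigh-initial (a ∷ q) w = trans (cong₂ _+_ (*-identityˡ _) (weigh-zero q w)) (+-identityʳ _)

weigh-[] : ∀ {m} c (q : Word m) → weigh c q [] ≡ c m
weigh-[] c []      = refl
weigh-[] c (a ∷ q) = trans (cong (_+ weigh (c ∘ suc) q []) (*-zeroʳ (c 0))) (weigh-[] (c ∘ suc) q)

module _ {ℓ} (p : Word ℓ) (k : ℕ) where
  open Automaton (letterAt p) ℓ k

  weigh-step : ∀ {n} c x (w : Word n) → weigh c p (x ∷ w) ≡ weigh (step c x) p w
  weigh-step c x w = trans (sym (weigh-inflow 0 c p x w))
    (weigh-cong p w λ { zero → +-identityʳ (c 0) ; (suc j) → refl })

  -- Fixing the first letter turns `occurrences p` into another function of the remaining word,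
  -- hence the general `h`.
  number-words : ∀ n c (h : Word n → ℕ) → (∀ w → h w ≡ weigh c p w) →
    number (λ w → h w ≟ k) (words n) ≡ count c n
  number-words zero c h eq = trans (number-∷ (λ w → h w ≟ k) [] [])
    (trans (+-identityʳ _) (cong (λ m → indicator (does (m ≟ k))) (trans (eq []) (weigh-[] c p))))
  number-words (suc n) c h eq = trans (number-cartesian (λ w → h w ≟ k) _∷_ false (true ∷ []) (words n))
    (cong₂ _+_ (branch false) (trans (number-cartesian (λ w → h w ≟ k) _∷_ true [] (words n))
      (trans (+-identityʳ _) (branch true))))
    where
    branch : ∀ x → number (λ w → h (x ∷ w) ≟ k) (words n) ≡ count (step c x) n
    branch x = number-words n (step c x) (h ∘ (x ∷_)) (λ w → trans (eq (x ∷ w)) (weigh-step c x w))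

  B≡count : ∀ n → B p n k ≡ count initial n
  B≡count n = number-words n initial (occurrences p) (λ w → sym (weigh-initial p w))

-- Runs

-- The word w starts with a maximal run of length m, and ms are the lengths of
-- the runs after it.
data Runs : ∀ {n} → Word (suc n) → ℕ → List ℕ → Set where
  single : ∀ {x} → Runs (x ∷ []) 1 []
  same   : ∀ {x n m ms} {w : Word n} → Runs (x ∷ w) m ms → Runs (x ∷ x ∷ w) (suc m) ms
  differ : ∀ {x y n m ms} {w : Word n} → x ≢ y → Runs (y ∷ w) m ms → Runs (x ∷ y ∷ w) 1 (m ∷ ms)

tagged : Bool → List⁺ Bool → List⁺ Bool ⊎ List⁺ Bool
tagged true  = inj₁
tagged false = inj₂

-- The tag of the first block is returned too, because `groupSeqsᵇ` inspects it to decide whether a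
-- new letter joins that block.
runs-Runs : ∀ {n} x (w : Word n) → Σ[ g ∈ List⁺ Bool ] Σ[ gs ∈ List (List⁺ Bool ⊎ List⁺ Bool) ]
  runs (x ∷ w) ≡ tagged x g ∷ gs × Runs (x ∷ w) (List⁺.length g) (map [ List⁺.length , List⁺.length ]′ gs)
runs-Runs true  [] = List⁺.[ true ] , [] , refl , single
runs-Runs false [] = List⁺.[ false ] , [] , refl , single
runs-Runs true  (true  ∷ w) with runs-Runs true w
... | g , gs , eq , R rewrite eq = true List⁺.∷⁺ g , gs , refl , same R
runs-Runs true  (false ∷ w) with runs-Runs false w
... | g , gs , eq , R rewrite eq = List⁺.[ true ] , inj₂ g ∷ gs , refl , differ (λ ()) R
runs-Runs false (true  ∷ w) with runs-Runs true w
... | g , gs , eq , R rewrite eq = List⁺.[ false ] , inj₁ g ∷ gs , refl , differ (λ ()) R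
runs-Runs false (false ∷ w) with runs-Runs false w
... | g , gs , eq , R rewrite eq = false List⁺.∷⁺ g , gs , refl , same R

runLengths-Runs : ∀ {n} (w : Word (suc n)) → ∃[ m ] ∃[ ms ] runLengths w ≡ m ∷ ms × Runs w m ms
runLengths-Runs (true ∷ w) with runs-Runs true w
... | g , gs , eq , R = _ , _ , cong (map [ List⁺.length , List⁺.length ]′) eq , R
runLengths-Runs (false ∷ w) with runs-Runs false w
... | g , gs , eq , R = _ , _ , cong (map [ List⁺.length , List⁺.length ]′) eq , R

RunIn : ∀ {n} → Word n → ℕ → ℕ → Set
RunIn {n} w = RunAt (letterAt w) n

-- Only a run at the very beginning gains a new left neighbour, which must differ from it.
shiftRun : ∀ {n} {w : Word n} {x start len} → (start ≡ 0 → x ≢ letterAt w 0) → RunIn w start len → RunIn (x ∷ w) (suc start) len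
shiftRun {n} {w} {x} {start} {len} separate run = record
  { letter   = letter
  ; nonempty = nonempty
  ; inside   = subst (_≤ suc n) (sym (+-suc len start)) (s≤s inside)
  ; constant = λ {t} t<len → trans (cong (letterAt (x ∷ w)) (+-suc t start)) (constant t<len)
  ; leftEnd  = leftEnd′ start refl ∘ suc-injective
  ; rightEnd = λ q eq → rightEnd (≤-pred (subst (_< suc n) (+-suc len start) q))
      (trans (cong (letterAt (x ∷ w)) (sym (+-suc len start))) eq)
  }
  where
  open RunAt run
  leftEnd′ : ∀ s → s ≡ start → ∀ {i} → i ≡ start → letterAt (x ∷ w) i ≢ letter
  leftEnd′ zero    eq refl = subst (λ i → letterAt (x ∷ w) i ≢ letter) eq
    λ x≡ → separate (sym eq) (trans x≡ (trans (sym (constant nonempty)) (cong (letterAt w) (sym eq))))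
  leftEnd′ (suc s) eq refl = subst (λ i → letterAt (x ∷ w) i ≢ letter) eq (leftEnd eq)

headRun : ∀ {n} {w : Word (suc n)} {m ms} → Runs w m ms → RunIn w 0 m
headRun {w = x ∷ _} single = record
  { letter = x ; nonempty = s≤s z≤n ; inside = s≤s z≤n
  ; constant = λ { {zero} _ → refl ; {suc _} (s≤s ()) } ; leftEnd = λ () ; rightEnd = λ { (s≤s ()) } }
headRun {w = x ∷ _} (same R) = record
  { letter = x ; nonempty = s≤s z≤n ; inside = s≤s inside
  ; constant = λ { {zero} _ → refl ; {suc t} (s≤s t<m) → trans (constant t<m) (sym first) }
  ; leftEnd = λ () ; rightEnd = λ { (s≤s q) eq → rightEnd q (trans eq first) } }
  where
  open RunAt (headRun R)
  first = constant nonempty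
headRun {w = x ∷ y ∷ _} (differ x≢y R) = record
  { letter = x ; nonempty = s≤s z≤n ; inside = s≤s z≤n
  ; constant = λ { {zero} _ → refl ; {suc _} (s≤s ()) } ; leftEnd = λ () ; rightEnd = λ _ → x≢y ∘ sym }

laterRun : ∀ {n} {w : Word (suc n)} {m ms L} → Runs w m ms → L ∈ ms → ∃[ i ] RunIn w (suc i) L
laterRun (same R) L∈ with laterRun R L∈
... | i , run = suc i , shiftRun (λ ()) run
laterRun (differ x≢y R) (here refl) = 0 , shiftRun (λ _ → x≢y) (headRun R)
laterRun (differ x≢y R) (there L∈) with laterRun R L∈
... | i , run = suc i , shiftRun (λ ()) run

soleRun : ∀ {n} {w : Word (suc n)} {m} → Runs w m [] → m ≡ suc n
soleRun single   = refl
soleRun (same R) = cong suc (soleRun R)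

lastRun : ∀ {n} {w : Word (suc n)} {m l ls L} → Runs w m (l ∷ ls) → last (l ∷ ls) ≡ just L →
  ∃[ i ] RunIn w (suc i) L × L + suc i ≡ suc n
lastRun (same R) eq with lastRun R eq
... | i , run , end = suc i , shiftRun (λ ()) run , trans (+-suc _ (suc i)) (cong suc end)
lastRun {ls = []} (differ x≢y R) refl =
  0 , shiftRun (λ _ → x≢y) (headRun R) , trans (+-comm _ 1) (cong suc (soleRun R))
lastRun {ls = _ ∷ _} (differ x≢y R) eq with lastRun R eq
... | i , run , end = suc i , shiftRun (λ ()) run , trans (+-suc _ (suc i)) (cong suc end)

headRun-proper : ∀ {n} {w : Word (suc n)} {m l ls} → Runs w m (l ∷ ls) → m < suc n
headRun-proper (same R)     = s≤s (headRun-proper R)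
headRun-proper (differ _ _) = s≤s (s≤s z≤n)

-- Gaps in terms of runs

wordGaps : ∀ {n} → Word (suc n) → ℕ → ℕ → ℕ
wordGaps {n} w = Gaps.gaps (letterAt w) (suc n)

wordGaps-∷ : ∀ {n} x (w : Word (suc n)) i m → wordGaps (x ∷ w) (2 + i) m ≡ wordGaps w (suc i) m
wordGaps-∷ x w i zero    = refl
wordGaps-∷ x w i (suc m) = cong (_ +_) (wordGaps-∷ x w (suc i) m)

-- Each of the `n` places between adjacent letters is either a gap or the beginning of a new run.
wordGaps+runs : ∀ {n} {w : Word (suc n)} {m ms} → Runs w m ms → wordGaps w 1 n + length ms ≡ n
wordGaps+runs single = refl
wordGaps+runs {suc n} {x ∷ x ∷ w} {ms = ms} (same R) rewrite dec-true (x Bool.≟ x) refl =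
  cong suc (trans (cong (_+ length ms) (wordGaps-∷ x (x ∷ w) 0 n)) (wordGaps+runs R))
wordGaps+runs {suc n} {x ∷ y ∷ w} {ms = m ∷ ms} (differ x≢y R) rewrite dec-false (x Bool.≟ y) x≢y =
  trans (cong (_+ suc (length ms)) (wordGaps-∷ x (y ∷ w) 0 n))
    (trans (+-suc (wordGaps (y ∷ w) 1 n) (length ms)) (cong suc (wordGaps+runs R)))

-- The gap 0 supplies the summand 1. With r = 1 + `length ms` and ℓ = n + 1, the rest is ℓ - r.
gaps≡degree : ∀ {n} {w : Word (suc n)} {m ms} → Runs w m ms → wordGaps w 0 (suc n) ≡ n ∸ length ms + 1
gaps≡degree {n} {w} {ms = ms} R = trans (+-comm 1 (wordGaps w 1 n))
  (cong (_+ 1) (trans (sym (m+n∸n≡m _ (length ms))) (cong (_∸ length ms) (wordGaps+runs R))))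

-- Eventual polynomials and their degrees

count-polynomial : ∀ {n} {w : Word (suc n)} {m l ls} k → 1 ≤ k → Runs w m (l ∷ ls) →
  ∃[ f ] EventuallyEqual (λ i → B w i k) f
       × DegreeAtMost f (wordGaps w 0 (suc n))
       × (Automaton.Path (letterAt w) (suc n) k (wordGaps w 0 (suc n)) initial → HasDegree f (wordGaps w 0 (suc n)))
count-polynomial {n} {w} {m} k 1≤k R =
  newtonPoly from 0 coeffs
  , newtonPoly-eventually (λ i → B w i k) from coeffs (λ i → trans (B≡count w k (from + i)) (formula i))
  , atMost
  , λ path → top path , atMost
  where
  open RunAt (headRun R)
  open Automaton (letterAt w) (suc n) k
  -- The first run supplies `a` and `b`; it is shorter than the word because a second run follows.
  open Growths (letterAt w) (suc n) k 1≤k letter m nonempty (headRun-proper R)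
    (λ {i} i<m → trans (cong (letterAt w) (sym (+-identityʳ i))) (constant i<m))
    (λ eq → rightEnd (subst (_< suc n) (sym (+-identityʳ m)) (headRun-proper R))
      (trans (cong (letterAt w) (+-identityʳ m)) eq))
  open Growth (growth (suc (room initial)) initial ≤-refl initial-Positive)

  length≤ : length coeffs ≤ suc (wordGaps w 0 (suc n))
  length≤ = ≤-trans bounded potential-initial

  atMost : DegreeAtMost (newtonPoly from 0 coeffs) (wordGaps w 0 (suc n))
  atMost i d<i = coeff-newtonPoly-≥ from 0 coeffs i (≤-trans length≤ d<i)

  top : Path (wordGaps w 0 (suc n)) initial → coeff (newtonPoly from 0 coeffs) (wordGaps w 0 (suc n)) ≢ 0ℚ
  top path with leading (λ _ → inj₁ refl) path
  -- The path gives a positive coefficient of index at least the degree bound; the length of the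
  -- series forces equality.
  ... | j , d≤j , 0<cj = coeff-newtonPoly-top from 0 coeffs (wordGaps w 0 (suc n)) length≤
    (subst (λ i → 0 < coeffs ‼ i) (≤-antisym j≤d d≤j) 0<cj)
    where
    j≤d : j ≤ wordGaps w 0 (suc n)
    j≤d = ≮⇒≥ λ d<j → <⇒≢ 0<cj (sym (‼-length coeffs j (≤-trans length≤ d<j)))

maximal-path : ∀ {n} {w : Word (suc n)} {m l ls} k → 1 ≤ k → runLengths w ≡ m ∷ l ∷ ls → Runs w m (l ∷ ls) →
  HasRun w 1 ⊎ (∃[ b ] 2 ≤ b × HasBoundaryRun w b × (∃[ s ] (b + s) C b ≡ k)) →
  Automaton.Path (letterAt w) (suc n) k (wordGaps w 0 (suc n)) initial
maximal-path {n} {w} (suc k) _ lengths R = route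
  where
  open Paths (letterAt w) (suc n) (suc k)
  open Stretch
  unit : ∀ {i} → RunIn w i 1 → Automaton.Path (letterAt w) (suc n) (suc k) (wordGaps w 0 (suc n)) initial
  -- A unit run needs C(1 + s, 1) to be the prescribed count, which is `suc k` here; so `s = k`.
  unit run = path-stretched {s = k} run (nC1≡n (suc k)) (inj₁ (inj₂ refl))
  route : _ → Automaton.Path (letterAt w) (suc n) (suc k) (wordGaps w 0 (suc n)) initial
  route (inj₁ has) with subst (1 ∈_) lengths has
  ... | here refl = unit (headRun R)
  ... | there 1∈  = unit (proj₂ (laterRun R 1∈))
  route (inj₂ (b , _ , boundary , s , eq)) rewrite lengths with boundary
  ... | inj₁ refl = path-stretched (headRun R) eq (inj₁ (inj₁ refl))
  ... | inj₂ end with lastRun R end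
  ...   | i , run , b+i = path-stretched run eq (inj₂ b+i)

precompose : ∀ {F H A : Set} {P Q S : F → Set} → (H → A) →
  ∃[ f ] P f × Q f × (A → S f) → ∃[ f ] P f × Q f × (H → S f)
precompose h (f , Pf , Qf , s) = f , Pf , Qf , s ∘ h

degree-of-B : ∀ {n} {w : Word (suc n)} {m l ls} k d → 1 ≤ k → runLengths w ≡ m ∷ l ∷ ls → Runs w m (l ∷ ls) →
  wordGaps w 0 (suc n) ≡ d →
  ∃[ f ] EventuallyEqual (λ i → B w i k) f
       × DegreeAtMost f d
       × (HasRun w 1 ⊎ (∃[ b ] 2 ≤ b × HasBoundaryRun w b × (∃[ s ] (b + s) C b ≡ k)) → HasDegree f d)
degree-of-B k d 1≤k lengths R refl = precompose (maximal-path k 1≤k lengths R) (count-polynomial k 1≤k R)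

theorem1p4 :
    (k : ℕ) → 1 ≤ k →
    (ℓ : ℕ) (p : Word ℓ) →
    (r : ℕ) → length (runs p) ≡ r → 2 ≤ r →
    ∃[ f ] EventuallyEqual (λ n → B p n k) f
         × DegreeAtMost f (ℓ ∸ r + 1)
         × (HasRun p 1
              ⊎ (∃[ b ] 2 ≤ b × HasBoundaryRun p b × (∃[ s ] (b + s) C b ≡ k))
            → HasDegree f (ℓ ∸ r + 1))
theorem1p4 k 1≤k zero    [] r eq 2≤r = contradiction (subst (2 ≤_) (sym eq) 2≤r) λ ()
theorem1p4 k 1≤k (suc n) p  r eq 2≤r = split (runLengths-Runs p)
  where
  r≡length : r ≡ length (runLengths p)
  r≡length = trans (sym eq) (sym (length-map _ (runs p)))

  split : (∃[ m ] ∃[ ms ] runLengths p ≡ m ∷ ms × Runs p m ms) →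
    ∃[ f ] EventuallyEqual (λ n → B p n k) f
         × DegreeAtMost f (suc n ∸ r + 1)
         × (HasRun p 1
              ⊎ (∃[ b ] 2 ≤ b × HasBoundaryRun p b × (∃[ s ] (b + s) C b ≡ k))
            → HasDegree f (suc n ∸ r + 1))
  split (m , [] , lengths , R) =
    contradiction (subst (2 ≤_) (trans r≡length (cong length lengths)) 2≤r) λ { (s≤s ()) }
  split (m , l ∷ ls , lengths , R) = degree-of-B k (suc n ∸ r + 1) 1≤k lengths R
    (trans (gaps≡degree R) (cong (λ m → suc n ∸ m + 1) (sym (trans r≡length (cong length lengths)))))
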